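{- Let $q$ be a prime power and let $A=(a_{ij})\in\mathbb{F}_q^{m\times k}$ be the coefficient matrix of a linear system $(\star)$: $\sum_{j=1}^k a_{ij}x_j=0$ ($i\in[m]$), in unknowns in $\mathbb{F}_q^n$. Assume $(\star)$ is a type (RC) linear system that is non-degenerate and irreducible. Suppose there is a partition $[k]=P_1\cup\dots\cup P_{2s}$ such that: (i) for all $r\in[s]$, the columns of $A$ indexed by $P_r\cup P_{s+r}$ sum to zero; (ii) if $(b_1,\dots,b_k)\in\mathbb{F}_q^k\setminus\{0\}$ is a nonzero linear combination of the rows of $A$, then $\sum_{j\in P_r}b_j\neq 0$ for at least two different values of $r\in[s]$; (iii) if $C$ is a column equivalence class of size $2$ that sums to zero, then there is some $r\in[s]$ with $C=P_r\cup P_{s+r}$. Then $(\star)$ is moderate.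
   Context: $(\star)$ is balanced if every row of $A$ sums to zero. Indices $j,j'\in[k]$ are equivalent if the $j$-th and $j'$-th columns of $A$ are nonzero scalar multiples of one another; the classes are the column equivalence classes; a class sums to zero if the columns indexed by it add up to the zero vector. Type (RC): balanced with at most one column equivalence class of size $1$. Non-degenerate: rows of $A$ linearly independent and every column nonzero. Two systems are equivalent if each equation of either is a linear combination of equations of the other; $(\star)$ is reducible if equivalent to a system whose variables can be partitioned into two or more classes with every equation using variables from only one class; irreducible otherwise. $(\star)$ is moderate if there exist $\beta,\gamma>0$ with $\gamma<q$ such that for every $n$ every $S\subseteq\mathbb{F}_q^n$ with $|S|\ge\beta\gamma^n$ contains a solution $(x_1,\dots,x_k)\in S^k$ of $(\star)$ with $x_1,\dots,x_k$ pairwise distinct. -}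

module Defs where

open import Level using (0ℓ)
open import Data.Nat as ℕ using (ℕ; zero; suc)
open import Data.Nat.Primality using (Prime)
open import Data.Fin as Fin using (Fin; _↑ˡ_; _↑ʳ_)
open import Data.Fin.Properties using () renaming (_≟_ to _≟ᶠ_)
open import Data.Bool using (Bool; true; false; if_then_else_)
open import Data.List as List using (List; []; _∷_)
open import Data.Vec using (Vec; []; _∷_; lookup)
open import Data.Product using (Σ; ∃; ∃-syntax; _×_; _,_)
open import Data.Sum using (_⊎_)
open import Data.Rational as ℚ using (ℚ; 1ℚ)
open import Data.Integer using () renaming (+_ to ℤ+_)
open import Data.Nat.ListAction using (sum)
open import Relation.Nullary using (¬_; does)
open import Relation.Binary.PropositionalEquality using (_≡_; _≢_)
open import Function.Bundles using (_↔_; Inverse)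
open import Function.Definitions using (Injective)
open import Algebra.Structures using (IsCommutativeRing)

IsPrimePower : ℕ → Set
IsPrimePower q = ∃[ p ] ∃[ e ] (Prime p × q ≡ p ℕ.^ suc e)

record FiniteField (q : ℕ) : Set₁ where
  field
    F    : Set
    _+_  : F → F → F
    _*_  : F → F → F
    -_   : F → F
    0#   : F
    1#   : F
    isCommutativeRing : IsCommutativeRing _≡_ _+_ _*_ -_ 0# 1#
    0≢1  : 0# ≢ 1#
    inv  : ∀ x → x ≢ 0# → ∃[ y ] (x * y ≡ 1#)
    enum : Fin q ↔ F

  infixl 7 _*_
  infixl 6 _+_

  elements : List F
  elements = List.map (Inverse.to enum) (List.allFin q)

  allVecs : (n : ℕ) → List (Vec F n)
  allVecs zero    = [] ∷ []
  allVecs (suc n) = List.concatMap (λ a → List.map (a ∷_) (allVecs n)) elements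

  card : ∀ {n} → (Vec F n → Bool) → ℕ
  card {n} S = sum (List.map (λ v → if S v then 1 else 0) (allVecs n))

  Σ[_] : ∀ {k} → (Fin k → F) → F
  Σ[_] {zero}  f = 0#
  Σ[_] {suc k} f = f Fin.zero + Σ[ (λ j → f (Fin.suc j)) ]

  ΣOver : ∀ {k} → (Fin k → Bool) → (Fin k → F) → F
  ΣOver P f = Σ[ (λ j → if P j then f j else 0#) ]

  Matrix : ℕ → ℕ → Set
  Matrix m k = Fin m → Fin k → F

  module _ {m k : ℕ} (A : Matrix m k) where

    rowComb : (Fin m → F) → Fin k → F
    rowComb λs j = Σ[ (λ i → λs i * A i j) ]

    Balanced : Set
    Balanced = ∀ i → Σ[ (λ j → A i j) ] ≡ 0#

    ColEquiv : Fin k → Fin k → Set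
    ColEquiv j j' = ∃[ c ] (c ≢ 0# × (∀ i → A i j ≡ c * A i j'))

    SingletonClass : Fin k → Set
    SingletonClass j = ∀ j' → ColEquiv j j' → j' ≡ j

    ClassIsPair : Fin k → Fin k → Set
    ClassIsPair j j' = j ≢ j' × ColEquiv j j' × (∀ j'' → ColEquiv j j'' → j'' ≡ j ⊎ j'' ≡ j')

    PairSumsToZero : Fin k → Fin k → Set
    PairSumsToZero j j' = ∀ i → A i j + A i j' ≡ 0#

    TypeRC : Set
    TypeRC = Balanced × (∀ j j' → SingletonClass j → SingletonClass j' → j ≡ j')

    NonDegenerate : Set
    NonDegenerate =
      (∀ λs → (∀ j → rowComb λs j ≡ 0#) → ∀ i → λs i ≡ 0#) ×
      (∀ j → ∃[ i ] (A i j ≢ 0#))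

  RowsIn : ∀ {m m' k} → Matrix m' k → Matrix m k → Set
  RowsIn {m} B A = ∀ i' → ∃[ λs ] (∀ j → B i' j ≡ rowComb A λs j)

  EquivSystems : ∀ {m m' k} → Matrix m k → Matrix m' k → Set
  EquivSystems A B = RowsIn B A × RowsIn A B

  Split : ∀ {m' k} → Matrix m' k → Set
  Split {m'} {k} B =
    Σ ℕ λ t → Σ (Fin k → Fin t) λ cls → (2 ℕ.≤ t × ((c : Fin t) → ∃[ j ] (cls j ≡ c)) ×
      (∀ i' → ∃[ c ] (∀ j → B i' j ≢ 0# → cls j ≡ c)))

  Reducible : ∀ {m k} → Matrix m k → Set
  Reducible {m} {k} A = ∃[ m' ] ∃[ B ] (EquivSystems {m} {m'} {k} A B × Split B)

  Irreducible : ∀ {m k} → Matrix m k → Set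
  Irreducible A = ¬ Reducible A

  IsSolution : ∀ {m k n} → Matrix m k → (Fin k → Vec F n) → Set
  IsSolution {n = n} A x = ∀ i (t : Fin n) → Σ[ (λ j → A i j * lookup (x j) t) ] ≡ 0#

  Moderate : ∀ {m k} → Matrix m k → Set
  Moderate {k = k} A =
    ∃[ β ] ∃[ γ ] (ℚ.Positive β × ℚ.Positive γ × γ ℚ.< ((ℤ+ q) ℚ./ 1) ×
      (∀ n (S : Vec F n → Bool) → β ℚ.* (γ ^ℚ n) ℚ.≤ ((ℤ+ card S) ℚ./ 1) →
        ∃[ x ] ((∀ j → S (x j) ≡ true) × Injective _≡_ _≡_ x × IsSolution A x)))
    where
      _^ℚ_ : ℚ → ℕ → ℚ
      g ^ℚ zero  = 1ℚ
      g ^ℚ suc e = g ℚ.* (g ^ℚ e)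

  module _ {m k : ℕ} (A : Matrix m k) (s : ℕ) (part : Fin k → Fin (s ℕ.+ s)) where

    inBlock : Fin (s ℕ.+ s) → Fin k → Bool
    inBlock r j = does (part j ≟ᶠ r)

    P : Fin s → Fin k → Bool
    P r = inBlock (r ↑ˡ s)

    P' : Fin s → Fin k → Bool
    P' r = inBlock (s ↑ʳ r)

    BlocksNonempty : Set
    BlocksNonempty = ∀ r → ∃[ j ] (part j ≡ r)

    CondI : Set
    CondI = ∀ (r : Fin s) i → ΣOver (λ j → if P r j then true else P' r j) (A i) ≡ 0#

    CondII : Set
    CondII = ∀ λs → (∃[ j ] (rowComb A λs j ≢ 0#)) →
      ∃[ r₁ ] ∃[ r₂ ] (r₁ ≢ r₂ × ΣOver (P r₁) (rowComb A λs) ≢ 0#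
                               × ΣOver (P r₂) (rowComb A λs) ≢ 0#)

    CondIII : Set
    CondIII = ∀ j j' → ClassIsPair A j j' → PairSumsToZero A j j' →
      ∃[ r ] (∀ t → (P r t ≡ true ⊎ P' r t ≡ true) → (t ≡ j ⊎ t ≡ j')) ×
             (∀ t → (t ≡ j ⊎ t ≡ j') → (P r t ≡ true ⊎ P' r t ≡ true))

{-# OPTIONS --safe #-}
module Submission where

-- Let Q = q ^ n, σ = |S| and δ = σ / Q. If a list of columns spans F ^ m, then in V ^ t every value
-- w ∈ V ^ m is attained by exactly Q ^ (t − m) tuples, since the number of tuples with a given value
-- is periodic in all directions.
--
-- Let c_r be the sum of the columns in P_r; by (i) the columns in P_{s+r} add up to − c_r. The system
-- with columns c_1, …, c_s, − c_1, …, − c_s has at least δ ^ (2s) Q ^ (2s − m) solutions in S by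
-- Cauchy–Schwarz. Replacing a column c + c′ by two columns c, c′ squares the density: write the number
-- of solutions as Σ_u Σ_x f(u, x) g(u, x), with f counting the columns from the blocks P_r and g those
-- from the blocks P_{s+r}, the split column left out. By (ii) each side spans even without one of its
-- blocks, which bounds f and g pointwise, and Cauchy–Schwarz over u applies. After k such steps the
-- blocks are refined into the columns of A, and S contains at least δ ^ e Q ^ (k − m) solutions, with
-- e independent of n.
--
-- By (i) and (ii) a nonzero row combination has nonzero sum over at least four blocks, so it is never
-- supported on two indices. Hence adding the equation x_i = x_j raises the rank, and there are at most
-- k² Q ^ (k − m − 1) degenerate solutions. If all solutions in S are degenerate then δ ^ e Q ≤ k².

open import Algebra.Bundles using (AbelianGroup; CommutativeRing; CommutativeSemiring)
import Algebra.Properties.CommutativeSemigroup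
import Algebra.Properties.Group
open import Algebra.Structures using (IsAbelianGroup; IsCommutativeRing)
open import Data.Bool using (Bool; true; false; if_then_else_)
open import Data.Empty using (⊥)
open import Data.Fin as Fin using (Fin; _↑ˡ_; _↑ʳ_; splitAt)
import Data.Fin.Properties as Finₚ
open import Data.Integer as ℤ using ()
import Data.Integer.Properties as ℤₚ
open import Data.List as List using (List; []; _∷_; _++_; length; allFin)
open import Data.List.Membership.Propositional using (_∈_; find)
open import Data.List.Membership.Propositional.Properties using (∈-map⁺; ∈-map⁻; ∈-++⁺ˡ; ∈-++⁺ʳ; ∈-allFin; ∈-tabulate⁺)
import Data.List.Properties as Listₚ
import Data.List.Relation.Binary.Permutation.Propositional as ↭
open import Data.List.Relation.Binary.Permutation.Propositional using (_↭_; ↭-sym; ↭-trans; ↭-reflexive)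
import Data.List.Relation.Binary.Permutation.Propositional.Properties as ↭ₚ
import Data.List.Relation.Unary.All as All
open import Data.List.Relation.Unary.All.Properties using (¬Any⇒All¬)
import Data.List.Relation.Unary.AllPairs as AllPairs
open import Data.List.Relation.Unary.Any as Any using (here; there)
open import Data.List.Relation.Unary.Unique.Propositional using (Unique)
import Data.List.Relation.Unary.Unique.Propositional.Properties as Uniqueₚ
open import Data.Nat as ℕ using (ℕ; zero; suc)
open import Data.Nat.ListAction using (sum)
open import Data.Nat.ListAction.Properties using (sum-++)
open import Data.Nat.Primality using (prime⇒nonTrivial; prime⇒nonZero)
import Data.Nat.Properties as ℕₚ
open import Data.Nat.Tactic.RingSolver using (solve-∀)
open import Data.Product using (∃; ∃-syntax; _×_; _,_; proj₁; proj₂)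
open import Data.Rational as ℚ using (ℚ; 1ℚ)
import Data.Rational.Properties as ℚₚ
open import Data.Rational.Unnormalised as ℚᵘ using (mkℚᵘ)
import Data.Rational.Unnormalised.Properties as ℚᵘₚ
open import Data.Sum using (_⊎_; inj₁; inj₂; [_,_]′)
open import Data.Vec as Vec using (Vec; []; _∷_; zipWith; replicate)
open import Data.Vec.Properties using (≡-dec; ∷-injective; zipWith-assoc; zipWith-comm; zipWith-identityˡ; zipWith-identityʳ; zipWith-inverseˡ; zipWith-inverseʳ; map-∘; map-cong; map-id; lookup∘tabulate; lookup-zipWith; lookup-replicate; lookup-map)
open import Defs
open import Function using (_∘_)
open import Function.Bundles using (Inverse)
open import Function.Definitions using (Injective)
open import Function.Properties.Inverse using (↔-sym; Inverse⇒Injection)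
open import Level using (0ℓ)
open import Relation.Binary.Definitions using (DecidableEquality)
open import Relation.Binary.PropositionalEquality
open import Relation.Nullary using (Dec; does; yes; no; contradiction; ¬?; ¬_)
open import Relation.Nullary.Decidable using (via-injection; decidable-stable)

-- Finite sums of natural numbers, Cauchy-Schwarz, and enumerations of finite types.

module Sums where
  open import Data.Nat using (_+_; _*_; _^_; _≤_; _<_; z≤n)
  open ℕₚ hiding (_≟_)
  open Algebra.Properties.CommutativeSemigroup +-commutativeSemigroup using ()
    renaming (interchange to +-interchange)

  private variable
    X Y : Set

  ∑ : List X → (X → ℕ) → ℕ
  ∑ xs f = sum (List.map f xs)

  ∑-cong : (xs : List X) {f g : X → ℕ} → (∀ x → f x ≡ g x) → ∑ xs f ≡ ∑ xs g
  ∑-cong []       eq = refl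
  ∑-cong (x ∷ xs) eq = cong₂ _+_ (eq x) (∑-cong xs eq)

  ∑-mono : (xs : List X) {f g : X → ℕ} → (∀ x → f x ≤ g x) → ∑ xs f ≤ ∑ xs g
  ∑-mono []       le = z≤n
  ∑-mono (x ∷ xs) le = +-mono-≤ (le x) (∑-mono xs le)

  ∑-+ : (xs : List X) (f g : X → ℕ) → ∑ xs (λ x → f x + g x) ≡ ∑ xs f + ∑ xs g
  ∑-+ []       f g = refl
  ∑-+ (x ∷ xs) f g =
    trans (cong (f x + g x +_) (∑-+ xs f g)) (+-interchange (f x) (g x) (∑ xs f) (∑ xs g))

  *-∑ : (xs : List X) (c : ℕ) (f : X → ℕ) → c * ∑ xs f ≡ ∑ xs (λ x → c * f x)
  *-∑ []       c f = *-zeroʳ c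
  *-∑ (x ∷ xs) c f = trans (*-distribˡ-+ c (f x) (∑ xs f)) (cong (c * f x +_) (*-∑ xs c f))

  ∑-* : (xs : List X) (c : ℕ) (f : X → ℕ) → ∑ xs f * c ≡ ∑ xs (λ x → f x * c)
  ∑-* xs c f = trans (*-comm (∑ xs f) c) (trans (*-∑ xs c f) (∑-cong xs λ x → *-comm c (f x)))

  ∑-zero : (xs : List X) → ∑ xs (λ _ → 0) ≡ 0
  ∑-zero []       = refl
  ∑-zero (x ∷ xs) = ∑-zero xs

  ∑-const : (xs : List X) (c : ℕ) → ∑ xs (λ _ → c) ≡ length xs * c
  ∑-const []       c = refl
  ∑-const (x ∷ xs) c = cong (c +_) (∑-const xs c)

  ∑-swap : (xs : List X) (ys : List Y) (f : X → Y → ℕ) →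
    ∑ xs (λ x → ∑ ys (f x)) ≡ ∑ ys (λ y → ∑ xs (λ x → f x y))
  ∑-swap []       ys f = sym (∑-zero ys)
  ∑-swap (x ∷ xs) ys f =
    trans (cong (∑ ys (f x) +_) (∑-swap xs ys f)) (sym (∑-+ ys (f x) (λ y → ∑ xs (λ x → f x y))))

  ∑-++ : (xs ys : List X) (f : X → ℕ) → ∑ (xs ++ ys) f ≡ ∑ xs f + ∑ ys f
  ∑-++ xs ys f = trans (cong sum (Listₚ.map-++ f xs ys)) (sum-++ (List.map f xs) (List.map f ys))

  ∑-concatMap : (xs : List X) (g : X → List Y) (f : Y → ℕ) →
    ∑ (List.concatMap g xs) f ≡ ∑ xs (λ x → ∑ (g x) f)
  ∑-concatMap []       g f = refl
  ∑-concatMap (x ∷ xs) g f =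
    trans (∑-++ (g x) (List.concatMap g xs) f) (cong (∑ (g x) f +_) (∑-concatMap xs g f))

  ∑-map : (g : X → Y) (xs : List X) (f : Y → ℕ) → ∑ (List.map g xs) f ≡ ∑ xs (f ∘ g)
  ∑-map g xs f = cong sum (sym (Listₚ.map-∘ xs))

  -- The terms are compared one by one, so a concrete witness comes out unless every term of f is at
  -- most that of g. Applied to `found` and `degenerate`, the witness becomes the solution with
  -- distinct entries.
  ∑≤⊎> : (xs : List X) (f g : X → ℕ) → ∑ xs f ≤ ∑ xs g ⊎ ∃[ x ] (g x < f x)
  ∑≤⊎> []       f g = inj₁ z≤n
  ∑≤⊎> (x ∷ xs) f g with ≤-<-connex (f x) (g x) | ∑≤⊎> xs f g
  ... | inj₂ gt | _       = inj₂ (x , gt)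
  ... | inj₁ le | inj₁ l  = inj₁ (+-mono-≤ le l)
  ... | inj₁ le | inj₂ gt = inj₂ gt

  -- The induction avoids subtraction: passing from (a, b) to (a + 1, b + 1) adds 2 + 2a + 2b to
  -- both sides.
  2ab≤a²+b² : ∀ a b → 2 * (a * b) ≤ a * a + b * b
  2ab≤a²+b² zero    b       = z≤n
  2ab≤a²+b² (suc a) zero    = ≤-trans (≤-reflexive (cong (2 *_) (*-zeroʳ a))) z≤n
  2ab≤a²+b² (suc a) (suc b) =
    subst₂ _≤_ (e₁ a b) (e₂ a b) (+-monoˡ-≤ (2 + 2 * a + 2 * b) (2ab≤a²+b² a b))
    where
    e₁ : ∀ a b → 2 * (a * b) + (2 + 2 * a + 2 * b) ≡ 2 * (suc a * suc b)
    e₁ = solve-∀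
    e₂ : ∀ a b → a * a + b * b + (2 + 2 * a + 2 * b) ≡ suc a * suc a + suc b * suc b
    e₂ = solve-∀

  -- The case of a second factor constantly 1. In the induction only the cross term is new;
  -- `2ab≤a²+b²` bounds it against each remaining entry.
  cauchy-schwarz : (xs : List X) (f : X → ℕ) →
    ∑ xs f * ∑ xs f ≤ length xs * ∑ xs (λ x → f x * f x)
  cauchy-schwarz []       f = z≤n
  cauchy-schwarz (x ∷ xs) f = begin
    (t + T) * (t + T)                     ≡⟨ e₁ t T ⟩
    t * t + 2 * (t * T) + T * T           ≤⟨ +-mono-≤ (+-monoʳ-≤ (t * t) cross) (cauchy-schwarz xs f) ⟩
    t * t + (n * (t * t) + U) + n * U     ≡⟨ e₂ (t * t) n U ⟩
    suc n * (t * t + U)                   ∎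
    where
    open ≤-Reasoning
    t T U n : ℕ
    t = f x
    T = ∑ xs f
    U = ∑ xs (λ x → f x * f x)
    n = length xs
    e₁ : ∀ t T → (t + T) * (t + T) ≡ t * t + 2 * (t * T) + T * T
    e₁ = solve-∀
    e₂ : ∀ a n u → a + (n * a + u) + n * u ≡ suc n * (a + u)
    e₂ = solve-∀
    cross : 2 * (t * T) ≤ n * (t * t) + U
    cross = begin
      2 * (t * T)                            ≡⟨ cong (2 *_) (*-∑ xs t f) ⟩
      2 * ∑ xs (λ y → t * f y)               ≡⟨ *-∑ xs 2 _ ⟩
      ∑ xs (λ y → 2 * (t * f y))             ≤⟨ ∑-mono xs (λ y → 2ab≤a²+b² t (f y)) ⟩
      ∑ xs (λ y → t * t + f y * f y)         ≡⟨ ∑-+ xs _ _ ⟩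
      ∑ xs (λ _ → t * t) + U                 ≡⟨ cong (_+ U) (∑-const xs (t * t)) ⟩
      n * (t * t) + U                        ∎

  ind : {P : Set} → Dec P → ℕ
  ind d = if does d then 1 else 0

  ind-yes : {P : Set} (d : Dec P) → P → ind d ≡ 1
  ind-yes (yes _) p = refl
  ind-yes (no ¬p) p = contradiction p ¬p

  ind⇒ : {P : Set} (d : Dec P) → 0 < ind d → P
  ind⇒ (yes p) _ = p

  ind-cong : {P Q : Set} (d : Dec P) (e : Dec Q) → (P → Q) → (Q → P) → ind d ≡ ind e
  ind-cong (yes p) e f g = sym (ind-yes e (f p))
  ind-cong (no ¬p) (yes q) f g = contradiction (g q) ¬p
  ind-cong (no ¬p) (no ¬q) f g = refl

  -- `once` says that `all` lists each element exactly once, in the form of a sum so that it can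
  -- evaluate other sums directly.
  record Finite (X : Set) : Set where
    infix 4 _≟_
    field
      all  : List X
      _≟_  : DecidableEquality X
      once : ∀ x → ∑ all (λ y → ind (x ≟ y)) ≡ 1

    ∑-pick : ∀ x (f : X → ℕ) → ∑ all (λ y → ind (x ≟ y) * f y) ≡ f x
    ∑-pick x f = begin
      ∑ all (λ y → ind (x ≟ y) * f y) ≡⟨ ∑-cong all at ⟩
      ∑ all (λ y → ind (x ≟ y) * f x) ≡⟨ ∑-* all (f x) _ ⟨
      ∑ all (λ y → ind (x ≟ y)) * f x ≡⟨ cong (_* f x) (once x) ⟩
      1 * f x                         ≡⟨ *-identityˡ (f x) ⟩
      f x                             ∎
      where
      open ≡-Reasoning
      at : ∀ y → ind (x ≟ y) * f y ≡ ind (x ≟ y) * f x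
      at y with x ≟ y
      ... | yes refl = refl
      ... | no _     = refl

    -- The terms are sorted by the value y of `π x`; the fibre over y is the single point `ρ y`.
    ∑-bijection : (π ρ : X → X) → (∀ x → π (ρ x) ≡ x) → (∀ x → ρ (π x) ≡ x) →
      (f : X → ℕ) → ∑ all (f ∘ π) ≡ ∑ all f
    ∑-bijection π ρ πρ ρπ f = begin
      ∑ all (λ x → f (π x))                                   ≡⟨ ∑-cong all (λ x → ∑-pick (π x) f) ⟨
      ∑ all (λ x → ∑ all (λ y → ind (π x ≟ y) * f y))         ≡⟨ ∑-swap all all _ ⟩
      ∑ all (λ y → ∑ all (λ x → ind (π x ≟ y) * f y))         ≡⟨ ∑-cong all (λ y → ∑-* all (f y) _) ⟨
      ∑ all (λ y → ∑ all (λ x → ind (π x ≟ y)) * f y)         ≡⟨ ∑-cong all (λ y → cong (_* f y) (fibre y)) ⟩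
      ∑ all (λ y → 1 * f y)                                   ≡⟨ ∑-cong all (λ y → *-identityˡ (f y)) ⟩
      ∑ all f                                                 ∎
      where
      open ≡-Reasoning
      fibre : ∀ y → ∑ all (λ x → ind (π x ≟ y)) ≡ 1
      fibre y = trans
        (∑-cong all λ x → ind-cong (π x ≟ y) (ρ y ≟ x)
          (λ e → trans (cong ρ (sym e)) (ρπ x)) (λ e → trans (cong π (sym e)) (πρ y)))
        (once (ρ y))

  -- The recursion of `allVecs` over an arbitrary list of entries, so that tuples of vectors are
  -- enumerated too.
  allVec : List X → ∀ n → List (Vec X n)
  allVec xs zero    = [] ∷ []
  allVec xs (suc n) = List.concatMap (λ a → List.map (a ∷_) (allVec xs n)) xs

  ∑-allVec : (xs : List X) (n : ℕ) (f : Vec X (suc n) → ℕ) →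
    ∑ (allVec xs (suc n)) f ≡ ∑ xs (λ a → ∑ (allVec xs n) (λ v → f (a ∷ v)))
  ∑-allVec xs n f = trans (∑-concatMap xs _ f) (∑-cong xs λ a → ∑-map (a ∷_) (allVec xs n) f)

  length≡∑ : (xs : List X) → length xs ≡ ∑ xs (λ _ → 1)
  length≡∑ xs = trans (sym (*-identityʳ (length xs))) (sym (∑-const xs 1))

  length-allVec : (xs : List X) (n : ℕ) → length (allVec xs n) ≡ length xs ^ n
  length-allVec xs zero    = refl
  length-allVec xs (suc n) = begin
    length (allVec xs (suc n))             ≡⟨ length≡∑ (allVec xs (suc n)) ⟩
    ∑ (allVec xs (suc n)) (λ _ → 1)        ≡⟨ ∑-allVec xs n _ ⟩
    ∑ xs (λ _ → ∑ (allVec xs n) (λ _ → 1)) ≡⟨ ∑-const xs _ ⟩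
    length xs * ∑ (allVec xs n) (λ _ → 1)  ≡⟨ cong (length xs *_) (length≡∑ (allVec xs n)) ⟨
    length xs * length (allVec xs n)       ≡⟨ cong (length xs *_) (length-allVec xs n) ⟩
    length xs * length xs ^ n              ∎
    where open ≡-Reasoning

  finiteVec : Finite X → ∀ n → Finite (Vec X n)
  finiteVec {X} fin n = record { all = allVec all n ; _≟_ = ≡-dec _≟_ ; once = once′ }
    where
    open Finite fin
    once′ : ∀ {n} (x : Vec X n) → ∑ (allVec all n) (λ y → ind (≡-dec _≟_ x y)) ≡ 1
    once′ []             = refl
    once′ {suc n} (x ∷ xs) = begin
      ∑ (allVec all (suc n)) (λ y → ind (≡-dec _≟_ (x ∷ xs) y))
        ≡⟨ ∑-allVec all n _ ⟩
      ∑ all (λ a → ∑ (allVec all n) (λ v → ind (≡-dec _≟_ (x ∷ xs) (a ∷ v))))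
        ≡⟨ ∑-cong all (λ a → ∑-cong (allVec all n) (split a)) ⟩
      ∑ all (λ a → ∑ (allVec all n) (λ v → ind (x ≟ a) * ind (≡-dec _≟_ xs v)))
        ≡⟨ ∑-cong all (λ a → *-∑ (allVec all n) (ind (x ≟ a)) _) ⟨
      ∑ all (λ a → ind (x ≟ a) * ∑ (allVec all n) (λ v → ind (≡-dec _≟_ xs v)))
        ≡⟨ ∑-pick x _ ⟩
      ∑ (allVec all n) (λ v → ind (≡-dec _≟_ xs v))
        ≡⟨ once′ xs ⟩
      1 ∎
      where
      open ≡-Reasoning
      split : ∀ a v → ind (≡-dec _≟_ (x ∷ xs) (a ∷ v)) ≡ ind (x ≟ a) * ind (≡-dec _≟_ xs v)
      split a v with x ≟ a
      ... | yes refl = sym (*-identityˡ (ind (≡-dec _≟_ xs v)))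
      ... | no x≢a   = refl

open Sums

-- Linear algebra over the field: vectors, functionals and spanning lists of columns.

vec-isAbelianGroup : {X : Set} {_∙_ : X → X → X} {ε : X} {_⁻¹ : X → X} →
  IsAbelianGroup _≡_ _∙_ ε _⁻¹ → ∀ n →
  IsAbelianGroup _≡_ (zipWith {n = n} _∙_) (replicate n ε) (Vec.map _⁻¹)
vec-isAbelianGroup g n = record
  { isGroup = record
    { isMonoid = record
      { isSemigroup = record
        { isMagma = record { isEquivalence = isEquivalence ; ∙-cong = cong₂ _ }
        ; assoc = zipWith-assoc G.assoc }
      ; identity = zipWith-identityˡ G.identityˡ , zipWith-identityʳ G.identityʳ }
    ; inverse = zipWith-inverseˡ G.inverseˡ , zipWith-inverseʳ G.inverseʳ
    ; ⁻¹-cong = cong _ }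
  ; comm = zipWith-comm G.comm }
  where module G = IsAbelianGroup g

module Linear {q : ℕ} (𝔽 : FiniteField q) where

  open FiniteField 𝔽
  module R = IsCommutativeRing isCommutativeRing

  infixl 6 _⊕_ _⊞_
  infixl 7 _·_ _⊗_

  commutativeRing : CommutativeRing 0ℓ 0ℓ
  commutativeRing = record { isCommutativeRing = isCommutativeRing }

  open Algebra.Properties.CommutativeSemigroup
    (CommutativeSemiring.*-commutativeSemigroup (CommutativeRing.commutativeSemiring commutativeRing))
    using (x∙yz≈y∙xz)
  open Algebra.Properties.CommutativeSemigroup
    (CommutativeRing.+-commutativeSemigroup commutativeRing) using (interchange)

  _≟F_ : DecidableEquality F
  _≟F_ = via-injection (Inverse⇒Injection (↔-sym enum)) Finₚ._≟_

  _⊕_ : ∀ {n} → Vec F n → Vec F n → Vec F n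
  _⊕_ = zipWith _+_

  _⊞_ : ∀ {n m} → Vec (Vec F n) m → Vec (Vec F n) m → Vec (Vec F n) m
  _⊞_ = zipWith _⊕_

  0V : ∀ {n} → Vec F n
  0V = replicate _ 0#

  0W : ∀ {n m} → Vec (Vec F n) m
  0W = replicate _ 0V

  ⊝_ : ∀ {n} → Vec F n → Vec F n
  ⊝_ = Vec.map -_

  ⊟_ : ∀ {n m} → Vec (Vec F n) m → Vec (Vec F n) m
  ⊟_ = Vec.map ⊝_

  _·_ : ∀ {n} → F → Vec F n → Vec F n
  a · v = Vec.map (a *_) v

  -- The outer product: what a variable x with coefficient column c contributes to the m equations.
  _⊗_ : ∀ {n m} → Vec F m → Vec F n → Vec (Vec F n) m
  c ⊗ x = Vec.map (_· x) c

  isAbelianGroupV : ∀ n → IsAbelianGroup _≡_ (_⊕_ {n}) 0V ⊝_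
  isAbelianGroupV = vec-isAbelianGroup R.+-isAbelianGroup

  isAbelianGroupW : ∀ n m → IsAbelianGroup _≡_ (_⊞_ {n} {m}) 0W ⊟_
  isAbelianGroupW n = vec-isAbelianGroup (isAbelianGroupV n)

  groupV : ℕ → AbelianGroup 0ℓ 0ℓ
  groupV n = record { isAbelianGroup = isAbelianGroupV n }

  groupW : ℕ → ℕ → AbelianGroup 0ℓ 0ℓ
  groupW n m = record { isAbelianGroup = isAbelianGroupW n m }

  module V {n} = IsAbelianGroup (isAbelianGroupV n)
  module W {n m} = IsAbelianGroup (isAbelianGroupW n m)

  ·-distribʳ : ∀ {n} a b (x : Vec F n) → (a + b) · x ≡ a · x ⊕ b · x
  ·-distribʳ a b []      = refl
  ·-distribʳ a b (y ∷ x) = cong₂ _∷_ (R.distribʳ y a b) (·-distribʳ a b x)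

  ·-distribˡ : ∀ {n} a (x y : Vec F n) → a · (x ⊕ y) ≡ a · x ⊕ a · y
  ·-distribˡ a []      []      = refl
  ·-distribˡ a (b ∷ x) (c ∷ y) = cong₂ _∷_ (R.distribˡ a b c) (·-distribˡ a x y)

  ·-assoc : ∀ {n} a b (x : Vec F n) → (a * b) · x ≡ a · (b · x)
  ·-assoc a b x = trans (map-cong (R.*-assoc a b) x) (map-∘ (a *_) (b *_) x)

  ·-identity : ∀ {n} (x : Vec F n) → 1# · x ≡ x
  ·-identity x = trans (map-cong R.*-identityˡ x) (map-id x)

  ·-zeroˡ : ∀ {n} (x : Vec F n) → 0# · x ≡ 0V
  ·-zeroˡ []      = refl
  ·-zeroˡ (a ∷ x) = cong₂ _∷_ (R.zeroˡ a) (·-zeroˡ x)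

  ⊗-distribʳ : ∀ {n m} (c d : Vec F m) (x : Vec F n) → (c ⊕ d) ⊗ x ≡ c ⊗ x ⊞ d ⊗ x
  ⊗-distribʳ []      []      x = refl
  ⊗-distribʳ (a ∷ c) (b ∷ d) x = cong₂ _∷_ (·-distribʳ a b x) (⊗-distribʳ c d x)

  ⊗-distribˡ : ∀ {n m} (c : Vec F m) (x y : Vec F n) → c ⊗ (x ⊕ y) ≡ c ⊗ x ⊞ c ⊗ y
  ⊗-distribˡ []      x y = refl
  ⊗-distribˡ (a ∷ c) x y = cong₂ _∷_ (·-distribˡ a x y) (⊗-distribˡ c x y)

  ·-⊗ : ∀ {n m} a (c : Vec F m) (x : Vec F n) → (a · c) ⊗ x ≡ c ⊗ (a · x)
  ·-⊗ a []      x = refl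
  ·-⊗ a (b ∷ c) x =
    cong₂ _∷_ (trans (cong (_· x) (R.*-comm a b)) (·-assoc b a x)) (·-⊗ a c x)

  ⊗-zeroˡ : ∀ {n m} (x : Vec F n) → 0V {m} ⊗ x ≡ 0W
  ⊗-zeroˡ {m = zero}  x = refl
  ⊗-zeroˡ {m = suc m} x = cong₂ _∷_ (·-zeroˡ x) (⊗-zeroˡ x)

  ⊝-⊗ : ∀ {n m} (c : Vec F m) (x : Vec F n) → (⊝ c) ⊗ x ≡ ⊟ (c ⊗ x)
  ⊝-⊗ c x = W-unique (c ⊗ x) ((⊝ c) ⊗ x)
    (trans (sym (⊗-distribʳ c (⊝ c) x)) (trans (cong (_⊗ x) (V.inverseʳ c)) (⊗-zeroˡ x)))
    where
    W-unique : ∀ {n m} (u v : Vec (Vec F n) m) → u ⊞ v ≡ 0W → v ≡ ⊟ u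
    W-unique {n} {m} = inverseʳ-unique
      where open Algebra.Properties.Group (AbelianGroup.group (groupW n m))

  dot : ∀ {m} → Vec F m → Vec F m → F
  dot l c = Σ[ (λ i → Vec.lookup l i * Vec.lookup c i) ]

  dot-⊕ : ∀ {m} (l c d : Vec F m) → dot l (c ⊕ d) ≡ dot l c + dot l d
  dot-⊕ []      []      []      = sym (R.+-identityˡ 0#)
  dot-⊕ (x ∷ l) (a ∷ c) (b ∷ d) =
    trans (cong₂ _+_ (R.distribˡ x a b) (dot-⊕ l c d)) (interchange (x * a) (x * b) (dot l c) (dot l d))

  dot-· : ∀ {m} (l : Vec F m) a (c : Vec F m) → dot l (a · c) ≡ a * dot l c
  dot-· []      a []      = sym (R.zeroʳ a)
  dot-· (x ∷ l) a (b ∷ c) =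
    trans (cong₂ _+_ (x∙yz≈y∙xz x a b) (dot-· l a c)) (sym (R.distribˡ a (x * b) (dot l c)))

  dot-zeroˡ : ∀ {m} (c : Vec F m) → dot 0V c ≡ 0#
  dot-zeroˡ []      = refl
  dot-zeroˡ (a ∷ c) = trans (cong₂ _+_ (R.zeroˡ a) (dot-zeroˡ c)) (R.+-identityˡ 0#)

  dot-zeroʳ : ∀ {m} (l : Vec F m) → dot l 0V ≡ 0#
  dot-zeroʳ []      = refl
  dot-zeroʳ (x ∷ l) = trans (cong₂ _+_ (R.zeroʳ x) (dot-zeroʳ l)) (R.+-identityˡ 0#)

  lookup⇒≡0V : ∀ {m} (l : Vec F m) → (∀ i → Vec.lookup l i ≡ 0#) → l ≡ 0V
  lookup⇒≡0V []      e = refl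
  lookup⇒≡0V (x ∷ l) e = cong₂ _∷_ (e Fin.zero) (lookup⇒≡0V l (e ∘ Fin.suc))

  Σ-cong : ∀ {k} {f g : Fin k → F} → (∀ j → f j ≡ g j) → Σ[ f ] ≡ Σ[ g ]
  Σ-cong {zero}  e = refl
  Σ-cong {suc k} e = cong₂ _+_ (e Fin.zero) (Σ-cong (e ∘ Fin.suc))

  ΣOver-cong : ∀ {k} (p : Fin k → Bool) {f g : Fin k → F} → (∀ j → f j ≡ g j) → ΣOver p f ≡ ΣOver p g
  ΣOver-cong p e = Σ-cong λ j → cong (λ z → if p j then z else 0#) (e j)

  Σ-+ : ∀ {k} (f g : Fin k → F) → Σ[ (λ j → f j + g j) ] ≡ Σ[ f ] + Σ[ g ]
  Σ-+ {zero}  f g = sym (R.+-identityˡ 0#)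
  Σ-+ {suc k} f g = trans (cong (f Fin.zero + g Fin.zero +_) (Σ-+ (f ∘ Fin.suc) (g ∘ Fin.suc)))
    (interchange _ _ _ _)

  ΣOver-∪ : ∀ {k} (p p′ : Fin k → Bool) → (∀ j → p j ≡ true → p′ j ≡ false) → (f : Fin k → F) →
    ΣOver p f + ΣOver p′ f ≡ ΣOver (λ j → if p j then true else p′ j) f
  ΣOver-∪ p p′ disjoint f =
    trans (sym (Σ-+ (λ j → if p j then f j else 0#) (λ j → if p′ j then f j else 0#))) (Σ-cong at)
    where
    at : ∀ j → (if p j then f j else 0#) + (if p′ j then f j else 0#)
             ≡ (if (if p j then true else p′ j) then f j else 0#)
    at j with p j | p′ j | disjoint j
    ... | true  | true  | d = contradiction (d refl) λ ()
    ... | true  | false | d = R.+-identityʳ (f j)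
    ... | false | true  | d = R.+-identityˡ (f j)
    ... | false | false | d = R.+-identityˡ 0#

  Kills : ∀ {m} → Vec F m → List (Vec F m) → Set
  Kills l cs = ∀ {c} → c ∈ cs → dot l c ≡ 0#

  -- Spanning in dual form, through functionals, because the hypotheses speak of row combinations,
  -- which are the values of `dot l` on the columns.
  Spanning : ∀ {m} → List (Vec F m) → Set
  Spanning cs = ∀ l → Kills l cs → l ≡ 0V

  -- Otherwise the first coordinate functional would kill the whole list.
  spanning⇒pivot : ∀ {m} (cs : List (Vec F (suc m))) → Spanning cs →
    ∃[ c ] (c ∈ cs × Vec.head c ≢ 0#)
  spanning⇒pivot cs span with Any.any? (λ c → ¬? (Vec.head c ≟F 0#)) cs
  ... | yes a = find a
  ... | no ¬a = contradiction (sym (proj₁ (∷-injective (span (1# ∷ 0V) kills)))) 0≢1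
    where
    kills : Kills (1# ∷ 0V) cs
    kills {a ∷ c} c∈ = trans (cong₂ _+_ (trans (R.*-identityˡ a) a≡0) (dot-zeroˡ c)) (R.+-identityˡ 0#)
      where
      a≡0 : a ≡ 0#
      a≡0 = decidable-stable (a ≟F 0#) (All.lookup (¬Any⇒All¬ cs ¬a) c∈)

  -- Gaussian elimination with the pivot column c₀ ∷ c, where c₀ * e ≡ - 1#.
  eliminate : ∀ {m} → F → Vec F m → Vec F (suc m) → Vec F m
  eliminate e c (a ∷ t) = t ⊕ (a * e) · c

  -- A functional l killing the eliminated columns extends, with first coefficient `dot l c * e`, to
  -- one killing the original columns.
  spanning-eliminate : ∀ {m} (cs : List (Vec F (suc m))) e (c : Vec F m) →
    Spanning cs → Spanning (List.map (eliminate e c) cs)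
  spanning-eliminate cs e c span l kills = proj₂ (∷-injective (span ((dot l c * e) ∷ l) kills′))
    where
    kills′ : Kills ((dot l c * e) ∷ l) cs
    kills′ {a ∷ t} at∈ = begin
      (dot l c * e) * a + dot l t        ≡⟨ trans (R.+-comm _ _) (cong (dot l t +_) (trans (R.*-comm _ a) (trans (cong (a *_) (R.*-comm (dot l c) e)) (sym (R.*-assoc a e (dot l c)))))) ⟩
      dot l t + (a * e) * dot l c        ≡⟨ cong (dot l t +_) (dot-· l (a * e) c) ⟨
      dot l t + dot l ((a * e) · c)      ≡⟨ dot-⊕ l t ((a * e) · c) ⟨
      dot l (eliminate e c (a ∷ t))          ≡⟨ kills (∈-map⁺ (eliminate e c) at∈) ⟩
      0#                                     ∎
      where open ≡-Reasoning

  -- Spanning in primal form, as an induction principle for predicates closed under addition.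
  -- Induction on m: a pivot column accounts for the first coordinate, and the eliminated columns
  -- generate the elements whose first coordinate is zero.
  spanning-generates : ∀ {n m} (cs : List (Vec F m)) → Spanning cs →
    (U : Vec (Vec F n) m → Set) → U 0W → (∀ {u v} → U u → U v → U (u ⊞ v)) →
    (∀ {c} → c ∈ cs → ∀ x → U (c ⊗ x)) → ∀ w → U w
  spanning-generates {m = zero}  cs span U u0 u+ uc [] = u0
  spanning-generates {n} {suc m} cs span U u0 u+ uc (y ∷ w) with spanning⇒pivot cs span
  ... | c₀ ∷ c , c∈ , c₀≢0 with inv c₀ c₀≢0
  ... | d , c₀d≡1 = subst U (cong₂ _∷_ head-eq tail-eq) (u+ (uc c∈ x) (U₀ (w ⊞ ⊟ (c ⊗ x))))
    where
    open ≡-Reasoning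
    -- The solution of `c₀ · x ≡ y`, with which the pivot column produces the head of the target.
    x : Vec F n
    x = d · y
    e : F
    e = - d
    c₀e+1≡0 : c₀ * e + 1# ≡ 0#
    c₀e+1≡0 = begin
      c₀ * - d + 1#      ≡⟨ cong (c₀ * - d +_) c₀d≡1 ⟨
      c₀ * - d + c₀ * d  ≡⟨ R.distribˡ c₀ (- d) d ⟨
      c₀ * (- d + d)     ≡⟨ cong (c₀ *_) (R.-‿inverseˡ d) ⟩
      c₀ * 0#            ≡⟨ R.zeroʳ c₀ ⟩
      0#                 ∎
    pivot-cancels : ∀ a → a + c₀ * (a * e) ≡ 0#
    pivot-cancels a = begin
      a + c₀ * (a * e)         ≡⟨ cong₂ _+_ (sym (R.*-identityʳ a)) (x∙yz≈y∙xz c₀ a e) ⟩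
      a * 1# + a * (c₀ * e)    ≡⟨ R.distribˡ a 1# (c₀ * e) ⟨
      a * (1# + c₀ * e)        ≡⟨ cong (a *_) (trans (R.+-comm 1# (c₀ * e)) c₀e+1≡0) ⟩
      a * 0#                   ≡⟨ R.zeroʳ a ⟩
      0#                       ∎
    eliminated : ∀ a t z → (a ∷ t) ⊗ z ⊞ (c₀ ∷ c) ⊗ ((a * e) · z) ≡ 0V ∷ eliminate e c (a ∷ t) ⊗ z
    eliminated a t z = cong₂ _∷_
      (begin
        a · z ⊕ c₀ · (μ · z)   ≡⟨ cong (a · z ⊕_) (·-assoc c₀ μ z) ⟨
        a · z ⊕ (c₀ * μ) · z   ≡⟨ ·-distribʳ a (c₀ * μ) z ⟨
        (a + c₀ * μ) · z       ≡⟨ cong (_· z) (pivot-cancels a) ⟩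
        0# · z                 ≡⟨ ·-zeroˡ z ⟩
        0V                     ∎)
      (begin
        t ⊗ z ⊞ c ⊗ (μ · z)    ≡⟨ cong (t ⊗ z ⊞_) (·-⊗ μ c z) ⟨
        t ⊗ z ⊞ (μ · c) ⊗ z    ≡⟨ ⊗-distribʳ t (μ · c) z ⟨
        (t ⊕ μ · c) ⊗ z        ∎)
      where
      μ : F
      μ = a * e
    -- An eliminated column at z is the sum of an original column at z and the pivot column at
    -- `(a * e) · z`; their first coordinates cancel.
    uc′ : ∀ {c′} → c′ ∈ List.map (eliminate e c) cs → ∀ z → U (0V ∷ c′ ⊗ z)
    uc′ c′∈ z with ∈-map⁻ (eliminate e c) c′∈
    ... | (a ∷ t) , at∈ , refl = subst U (eliminated a t z) (u+ (uc at∈ z) (uc c∈ _))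
    U₀ : ∀ w′ → U (0V ∷ w′)
    U₀ = spanning-generates (List.map (eliminate e c) cs) (spanning-eliminate cs e c span)
      (λ w′ → U (0V ∷ w′)) u0
      (λ {u} {v} p r → subst (λ z → U (z ∷ u ⊞ v)) (V.identityˡ 0V) (u+ p r)) uc′
    head-eq : c₀ · x ⊕ 0V ≡ y
    head-eq = begin
      c₀ · (d · y) ⊕ 0V  ≡⟨ V.identityʳ _ ⟩
      c₀ · (d · y)       ≡⟨ ·-assoc c₀ d y ⟨
      (c₀ * d) · y       ≡⟨ cong (_· y) c₀d≡1 ⟩
      1# · y             ≡⟨ ·-identity y ⟩
      y                  ∎
    tail-eq : c ⊗ x ⊞ (w ⊞ ⊟ (c ⊗ x)) ≡ w
    tail-eq = begin
      c ⊗ x ⊞ (w ⊞ ⊟ (c ⊗ x))  ≡⟨ W.comm _ _ ⟩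
      w ⊞ ⊟ (c ⊗ x) ⊞ c ⊗ x    ≡⟨ W.assoc w _ _ ⟩
      w ⊞ (⊟ (c ⊗ x) ⊞ c ⊗ x)  ≡⟨ cong (w ⊞_) (W.inverseˡ (c ⊗ x)) ⟩
      w ⊞ 0W                   ≡⟨ W.identityʳ w ⟩
      w                        ∎

-- Counting weighted solutions of linear systems by convolution.

module Counting {q : ℕ} (𝔽 : FiniteField q) (finiteF : Finite (FiniteField.F 𝔽)) (n m : ℕ) where

  open import Data.Nat using (_+_; _*_; _^_; _≤_)
  open ℕₚ using (*-assoc; *-comm; *-identityˡ; *-mono-≤; *-monoʳ-≤; *-monoˡ-≤; ≤-refl; ≤-trans; ≤-reflexive; ^-distribˡ-+-*)
  open Algebra.Properties.CommutativeSemigroup ℕₚ.*-commutativeSemigroup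
    using () renaming (x∙yz≈y∙xz to *-left-comm)
  open FiniteField 𝔽 using (F)
  open Linear 𝔽

  finiteV : Finite (Vec F n)
  finiteV = finiteVec finiteF n

  finiteW : Finite (Vec (Vec F n) m)
  finiteW = finiteVec finiteV m

  open Finite finiteV using () renaming (all to allV; ∑-bijection to ∑V-bijection)
  open Finite finiteW using (_≟_; ∑-pick) renaming (all to allW; ∑-bijection to ∑W-bijection)

  Q : ℕ
  Q = length allV

  length-allW : length allW ≡ Q ^ m
  length-allW = length-allVec allV m

  private
    module GV = Algebra.Properties.Group (AbelianGroup.group (groupV n))
    module GW = Algebra.Properties.Group (AbelianGroup.group (groupW n m))
  open Algebra.Properties.CommutativeSemigroup (AbelianGroup.commutativeSemigroup (groupW n m))
    using (xy∙z≈xz∙y; interchange)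

  ∑V-translate : ∀ v (f : Vec F n → ℕ) → ∑ allV (λ x → f (v ⊕ x)) ≡ ∑ allV f
  ∑V-translate v = ∑V-bijection (v ⊕_) (⊝ v ⊕_) (GV.\\-leftDividesˡ v) (GV.\\-leftDividesʳ v)

  ∑W-translate : ∀ v (f : Vec (Vec F n) m → ℕ) → ∑ allW (λ w → f (w ⊞ v)) ≡ ∑ allW f
  ∑W-translate v = ∑W-bijection (_⊞ v) (_⊞ ⊟ v) (GW.//-rightDividesˡ v) (GW.//-rightDividesʳ v)

  -- hist S (c₁ ∷ … ∷ c_t ∷ []) w is the S-weighted number of (x₁,…,x_t) with w + Σ cᵢ ⊗ xᵢ = 0.
  hist : (Vec F n → ℕ) → List (Vec F m) → Vec (Vec F n) m → ℕ
  hist S []       w = ind (w ≟ 0W)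
  hist S (c ∷ cs) w = ∑ allV λ x → S x * hist S cs (w ⊞ c ⊗ x)

  module _ (S : Vec F n → ℕ) where

    -- Each tuple solves the equation for exactly one offset w, so the sum over w counts all tuples.
    ∑-hist : ∀ cs → ∑ allW (hist S cs) ≡ ∑ allV S ^ length cs
    ∑-hist []       = trans (∑-cong allW λ w → ind-cong (w ≟ 0W) (0W ≟ w) sym sym) (Finite.once finiteW 0W)
    ∑-hist (c ∷ cs) = begin
      ∑ allW (λ w → ∑ allV λ x → S x * hist S cs (w ⊞ c ⊗ x))
        ≡⟨ ∑-swap allW allV _ ⟩
      ∑ allV (λ x → ∑ allW λ w → S x * hist S cs (w ⊞ c ⊗ x))
        ≡⟨ ∑-cong allV (λ x → *-∑ allW (S x) _) ⟨
      ∑ allV (λ x → S x * ∑ allW (λ w → hist S cs (w ⊞ c ⊗ x)))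
        ≡⟨ ∑-cong allV (λ x → cong (S x *_) (trans (∑W-translate (c ⊗ x) _) (∑-hist cs))) ⟩
      ∑ allV (λ x → S x * ∑ allV S ^ length cs)
        ≡⟨ ∑-* allV _ S ⟨
      ∑ allV S * ∑ allV S ^ length cs ∎
      where open ≡-Reasoning

    -- Negating the whole equation keeps its solutions.
    hist-neg : ∀ cs w → hist S (List.map ⊝_ cs) (⊟ w) ≡ hist S cs w
    hist-neg []       w = ind-cong (⊟ w ≟ 0W) (w ≟ 0W)
      (λ e → trans (sym (GW.⁻¹-involutive w)) (trans (cong ⊟_ e) GW.ε⁻¹≈ε))
      (λ e → trans (cong ⊟_ e) GW.ε⁻¹≈ε)
    hist-neg (c ∷ cs) w = ∑-cong allV λ x → cong (S x *_)
      (trans (cong (hist S (List.map ⊝_ cs))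
                 (trans (cong (⊟ w ⊞_) (⊝-⊗ c x)) (sym (⊟-⊞ w (c ⊗ x)))))
               (hist-neg cs (w ⊞ c ⊗ x)))
      where
      ⊟-⊞ : ∀ (u v : Vec (Vec F n) m) → ⊟ (u ⊞ v) ≡ ⊟ u ⊞ ⊟ v
      ⊟-⊞ u v = trans (GW.⁻¹-anti-homo-∙ u v) (W.comm (⊟ v) (⊟ u))

    -- A convolution: u is the total of the columns `ds`, which has to cancel against w and the
    -- total of `cs`.
    hist-++ : ∀ cs ds w → hist S (cs ++ ds) w ≡ ∑ allW (λ u → hist S cs (w ⊞ u) * hist S ds (⊟ u))
    hist-++ [] ds w = begin
      hist S ds w                                                ≡⟨ cong (hist S ds) (GW.⁻¹-involutive w) ⟨
      hist S ds (⊟ (⊟ w))                                        ≡⟨ ∑-pick (⊟ w) (λ u → hist S ds (⊟ u)) ⟨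
      ∑ allW (λ u → ind (⊟ w ≟ u) * hist S ds (⊟ u))             ≡⟨ ∑-cong allW (λ u → cong (_* hist S ds (⊟ u)) (at u)) ⟩
      ∑ allW (λ u → ind (w ⊞ u ≟ 0W) * hist S ds (⊟ u))          ∎
      where
      open ≡-Reasoning
      at : ∀ u → ind (⊟ w ≟ u) ≡ ind (w ⊞ u ≟ 0W)
      at u = ind-cong (⊟ w ≟ u) (w ⊞ u ≟ 0W)
        (λ e → trans (cong (w ⊞_) (sym e)) (W.inverseʳ w))
        (λ e → sym (GW.inverseʳ-unique w u e))
    hist-++ (c ∷ cs) ds w = begin
      ∑ allV (λ x → S x * hist S (cs ++ ds) (w ⊞ c ⊗ x))
        ≡⟨ ∑-cong allV (λ x → cong (S x *_) (hist-++ cs ds (w ⊞ c ⊗ x))) ⟩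
      ∑ allV (λ x → S x * ∑ allW (λ u → hist S cs (w ⊞ c ⊗ x ⊞ u) * hist S ds (⊟ u)))
        ≡⟨ ∑-cong allV (λ x → *-∑ allW (S x) _) ⟩
      ∑ allV (λ x → ∑ allW (λ u → S x * (hist S cs (w ⊞ c ⊗ x ⊞ u) * hist S ds (⊟ u))))
        ≡⟨ ∑-swap allV allW _ ⟩
      ∑ allW (λ u → ∑ allV (λ x → S x * (hist S cs (w ⊞ c ⊗ x ⊞ u) * hist S ds (⊟ u))))
        ≡⟨ ∑-cong allW (λ u → trans (∑-cong allV (λ x → at u x)) (sym (∑-* allV (hist S ds (⊟ u)) _))) ⟩
      ∑ allW (λ u → hist S (c ∷ cs) (w ⊞ u) * hist S ds (⊟ u)) ∎
      where
      open ≡-Reasoning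
      at : ∀ u x → S x * (hist S cs (w ⊞ c ⊗ x ⊞ u) * hist S ds (⊟ u))
                 ≡ S x * hist S cs (w ⊞ u ⊞ c ⊗ x) * hist S ds (⊟ u)
      at u x = trans (sym (*-assoc (S x) _ _))
        (cong (λ z → S x * hist S cs z * hist S ds (⊟ u)) (xy∙z≈xz∙y w (c ⊗ x) u))

    hist-↭ : ∀ {cs ds} → cs ↭ ds → ∀ w → hist S cs w ≡ hist S ds w
    hist-↭ ↭.refl        w = refl
    hist-↭ (↭.prep c p)    w = ∑-cong allV λ x → cong (S x *_) (hist-↭ p (w ⊞ c ⊗ x))
    hist-↭ (↭.trans p r)   w = trans (hist-↭ p w) (hist-↭ r w)
    hist-↭ (↭.swap {cs} {ds} c d p) w = begin
      ∑ allV (λ x → S x * ∑ allV (λ y → S y * hist S cs (w ⊞ c ⊗ x ⊞ d ⊗ y)))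
        ≡⟨ ∑-cong allV (λ x → *-∑ allV (S x) _) ⟩
      ∑ allV (λ x → ∑ allV (λ y → S x * (S y * hist S cs (w ⊞ c ⊗ x ⊞ d ⊗ y))))
        ≡⟨ ∑-swap allV allV _ ⟩
      ∑ allV (λ y → ∑ allV (λ x → S x * (S y * hist S cs (w ⊞ c ⊗ x ⊞ d ⊗ y))))
        ≡⟨ ∑-cong allV (λ y → trans (∑-cong allV (λ x → at x y)) (sym (*-∑ allV (S y) _))) ⟩
      ∑ allV (λ y → S y * ∑ allV (λ x → S x * hist S ds (w ⊞ d ⊗ y ⊞ c ⊗ x))) ∎
      where
      open ≡-Reasoning
      at : ∀ x y → S x * (S y * hist S cs (w ⊞ c ⊗ x ⊞ d ⊗ y)) ≡ S y * (S x * hist S ds (w ⊞ d ⊗ y ⊞ c ⊗ x))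
      at x y = trans (*-left-comm (S x) (S y) _)
        (cong (λ z → S y * (S x * z))
          (trans (cong (hist S cs) (xy∙z≈xz∙y w (c ⊗ x) (d ⊗ y))) (hist-↭ p _)))

  count : List (Vec F m) → Vec (Vec F n) m → ℕ
  count = hist (λ _ → 1)

  hist≤count : ∀ S → (∀ x → S x ≤ 1) → ∀ cs w → hist S cs w ≤ count cs w
  hist≤count S S≤1 []       w = ≤-refl
  hist≤count S S≤1 (c ∷ cs) w = ∑-mono allV λ x → *-mono-≤ (S≤1 x) (hist≤count S S≤1 cs (w ⊞ c ⊗ x))

  -- The variable belonging to c ranges over all vectors, so its sum absorbs the shift by x.
  count-periodic : ∀ cs {c} → c ∈ cs → ∀ x w → count cs (w ⊞ c ⊗ x) ≡ count cs w
  count-periodic (c ∷ cs) (here refl) x w = begin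
    ∑ allV (λ y → 1 * count cs (w ⊞ c ⊗ x ⊞ c ⊗ y))  ≡⟨ ∑-cong allV (λ y → cong (λ z → 1 * count cs z) (trans (W.assoc w _ _) (cong (w ⊞_) (sym (⊗-distribˡ c x y))))) ⟩
    ∑ allV (λ y → 1 * count cs (w ⊞ c ⊗ (x ⊕ y)))    ≡⟨ ∑V-translate x (λ y → 1 * count cs (w ⊞ c ⊗ y)) ⟩
    ∑ allV (λ y → 1 * count cs (w ⊞ c ⊗ y))          ∎
    where open ≡-Reasoning
  count-periodic (d ∷ cs) {c} (there c∈) x w = ∑-cong allV λ y → cong (1 *_)
    (trans (cong (count cs) (xy∙z≈xz∙y w (c ⊗ x) (d ⊗ y))) (count-periodic cs c∈ x (w ⊞ d ⊗ y)))

  -- All `c ⊗ x` are periods of `count cs`, and together they generate everything, so the count is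
  -- constant and equal to its average. The factor `Q ^ m` avoids a division.
  count-spanning : ∀ cs → Spanning cs → ∀ w → Q ^ m * count cs w ≡ Q ^ length cs
  count-spanning cs span w = begin
    Q ^ m * count cs w                 ≡⟨ cong (_* count cs w) length-allW ⟨
    length allW * count cs w           ≡⟨ ∑-const allW _ ⟨
    ∑ allW (λ _ → count cs w)          ≡⟨ ∑-cong allW (λ u → trans (constant w) (sym (constant u))) ⟩
    ∑ allW (count cs)                  ≡⟨ ∑-hist (λ _ → 1) cs ⟩
    ∑ allV (λ _ → 1) ^ length cs       ≡⟨ cong (_^ length cs) (length≡∑ allV) ⟨
    Q ^ length cs                      ∎
    where
    open ≡-Reasoning
    constant : ∀ u → count cs u ≡ count cs 0W
    constant u = trans (cong (count cs) (sym (W.identityˡ u)))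
      (spanning-generates cs span (λ u → ∀ w → count cs (w ⊞ u) ≡ count cs w)
        (λ w → cong (count cs) (W.identityʳ w))
        (λ {u} {v} p r w → trans (cong (count cs) (sym (W.assoc w u v))) (trans (r (w ⊞ u)) (p w)))
        (λ c∈ → count-periodic cs c∈) u 0W)

  hist-spanning : ∀ S → (∀ x → S x ≤ 1) → ∀ cs → Spanning cs → ∀ w → Q ^ m * hist S cs w ≤ Q ^ length cs
  hist-spanning S S≤1 cs span w =
    ≤-trans (*-monoʳ-≤ (Q ^ m) (hist≤count S S≤1 cs w)) (≤-reflexive (count-spanning cs span w))

  -- Lower bounds for the number of solutions in S.

  module Density (S : Vec F n → ℕ) (S≤1 : ∀ x → S x ≤ 1) where

    σ : ℕ
    σ = ∑ allV S

    σ≤Q : σ ≤ Q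
    σ≤Q = ≤-trans (∑-mono allV S≤1) (≤-reflexive (sym (length≡∑ allV)))

    instance
      Q-nonZero : ℕ.NonZero Q
      Q-nonZero = nonempty allV (Finite.once finiteV 0V)
        where
        nonempty : {X : Set} {f : X → ℕ} (xs : List X) → ∑ xs f ≡ 1 → ℕ.NonZero (length xs)
        nonempty (x ∷ xs) _ = _

    Q^-nonZero : ∀ e → ℕ.NonZero (Q ^ e)
    Q^-nonZero e = ℕₚ.m^n≢0 Q e

    -- The number of S-solutions is at least (σ / Q) ^ e times the expected number Q ^ (length cs − m).
    Dense : ℕ → List (Vec F m) → Set
    Dense e cs = σ ^ e * Q ^ length cs ≤ hist S cs 0W * (Q ^ m * Q ^ e)

    dense-↭ : ∀ {e cs ds} → cs ↭ ds → Dense e cs → Dense e ds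
    dense-↭ {e} p = subst₂ _≤_ (cong (λ l → σ ^ e * Q ^ l) (↭ₚ.↭-length p)) (cong (_* (Q ^ m * Q ^ e)) (hist-↭ S p 0W))

    -- As `σ ≤ Q`, a larger exponent only weakens the bound. It serves to make the final exponent
    -- positive.
    dense-suc : ∀ {e cs} → Dense e cs → Dense (suc e) cs
    dense-suc {e} {cs} dense = begin
      σ * σ ^ e * Q ^ length cs                  ≡⟨ *-assoc σ _ _ ⟩
      σ * (σ ^ e * Q ^ length cs)                ≤⟨ *-mono-≤ σ≤Q dense ⟩
      Q * (hist S cs 0W * (Q ^ m * Q ^ e))       ≡⟨ rearrange Q (hist S cs 0W) (Q ^ m) (Q ^ e) ⟩
      hist S cs 0W * (Q ^ m * (Q * Q ^ e))       ∎
      where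
      open ℕₚ.≤-Reasoning
      rearrange : ∀ a h b c → a * (h * (b * c)) ≡ h * (b * (a * c))
      rearrange = solve-∀

    -- A zero column leaves its variable free: it contributes a factor σ to the number of solutions
    -- and a factor Q to the expected number, and `σ ≤ Q`.
    dense-zero : ∀ {e cs} → Dense e (0V ∷ cs) → Dense e cs
    dense-zero {e} {cs} dense = ℕₚ.*-cancelˡ-≤ Q (begin
      Q * (σ ^ e * Q ^ length cs)                ≡⟨ *-left-comm Q (σ ^ e) _ ⟩
      σ ^ e * (Q * Q ^ length cs)                ≤⟨ dense ⟩
      hist S (0V ∷ cs) 0W * (Q ^ m * Q ^ e)      ≡⟨ cong (_* (Q ^ m * Q ^ e)) hist-zero ⟩
      σ * hist S cs 0W * (Q ^ m * Q ^ e)         ≤⟨ *-monoˡ-≤ _ (*-monoˡ-≤ _ σ≤Q) ⟩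
      Q * hist S cs 0W * (Q ^ m * Q ^ e)         ≡⟨ *-assoc Q _ _ ⟩
      Q * (hist S cs 0W * (Q ^ m * Q ^ e))       ∎)
      where
      open ℕₚ.≤-Reasoning
      hist-zero : hist S (0V ∷ cs) 0W ≡ σ * hist S cs 0W
      hist-zero = trans
        (∑-cong allV λ x → cong (λ z → S x * hist S cs z) (trans (cong (0W ⊞_) (⊗-zeroˡ x)) (W.identityˡ 0W)))
        (sym (∑-* allV _ S))

    -- The number of solutions is the sum of the squares of `hist S cs`, which Cauchy-Schwarz bounds
    -- below by the square of its total divided by `Q ^ m`.
    dense-base : ∀ cs → Dense (length cs + length cs) (cs ++ List.map ⊝_ cs)
    dense-base cs = begin
      σ ^ (t + t) * Q ^ length (cs ++ List.map ⊝_ cs)   ≡⟨ cong₂ _*_ (^-distribˡ-+-* σ t t) (cong (Q ^_) (trans (Listₚ.length-++ cs) (cong (t +_) (Listₚ.length-map ⊝_ cs)))) ⟩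
      σ ^ t * σ ^ t * Q ^ (t + t)                       ≡⟨ cong (_* Q ^ (t + t)) (cong₂ _*_ (sym (∑-hist S cs)) (sym (∑-hist S cs))) ⟩
      ∑ allW (hist S cs) * ∑ allW (hist S cs) * Q ^ (t + t)
                                                        ≤⟨ *-monoˡ-≤ (Q ^ (t + t)) (cauchy-schwarz allW (hist S cs)) ⟩
      length allW * ∑ allW (λ u → hist S cs u * hist S cs u) * Q ^ (t + t)
                                                        ≡⟨ cong₂ (λ a b → a * b * Q ^ (t + t)) length-allW (sym energy) ⟩
      Q ^ m * H * Q ^ (t + t)                           ≡⟨ rearrange (Q ^ m) H (Q ^ (t + t)) ⟩
      H * (Q ^ m * Q ^ (t + t))                         ∎
      where
      open ℕₚ.≤-Reasoning
      t H : ℕ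
      t = length cs
      H = hist S (cs ++ List.map ⊝_ cs) 0W
      energy : H ≡ ∑ allW (λ u → hist S cs u * hist S cs u)
      energy = trans (hist-++ S cs (List.map ⊝_ cs) 0W)
        (∑-cong allW λ u → cong₂ _*_ (cong (hist S cs) (W.identityˡ u)) (hist-neg S cs u))
      rearrange : ∀ a b c → a * b * c ≡ b * (a * c)
      rearrange = solve-∀

    -- Splitting one column into two.

    module Splitting (c d : Vec F m) (L R : List (Vec F m)) where

      -- Here u is the total of `d ⊗ y` and the columns R. So `f u x` counts fillings of L with
      -- total - u - c ⊗ x, and `g u y` fillings of R with total u - d ⊗ y.
      f g : Vec (Vec F n) m → Vec F n → ℕ
      f u x = hist S L (c ⊗ x ⊞ u)
      g u y = hist S R (⊟ (u ⊞ ⊟ (d ⊗ y)))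

      convolution : ∀ x y → hist S (L ++ R) (0W ⊞ c ⊗ x ⊞ d ⊗ y) ≡ ∑ allW (λ u → f u x * g u y)
      convolution x y = begin
        hist S (L ++ R) w                                       ≡⟨ hist-++ S L R w ⟩
        -- Translating u by - d ⊗ y frees the first factor of y; the two factors then depend on x
        -- and y separately.
        ∑ allW (λ u → hist S L (w ⊞ u) * hist S R (⊟ u))        ≡⟨ ∑W-translate (⊟ (d ⊗ y)) _ ⟨
        ∑ allW (λ u → hist S L (w ⊞ (u ⊞ ⊟ (d ⊗ y))) * g u y)   ≡⟨ ∑-cong allW (λ u → cong (λ z → hist S L z * g u y) (shift u)) ⟩
        ∑ allW (λ u → f u x * g u y)                            ∎
        where
        open ≡-Reasoning
        w : Vec (Vec F n) m
        w = 0W ⊞ c ⊗ x ⊞ d ⊗ y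
        shift : ∀ u → w ⊞ (u ⊞ ⊟ (d ⊗ y)) ≡ c ⊗ x ⊞ u
        shift u = begin
          w ⊞ (u ⊞ ⊟ (d ⊗ y))                          ≡⟨ interchange (0W ⊞ c ⊗ x) (d ⊗ y) u _ ⟩
          (0W ⊞ c ⊗ x ⊞ u) ⊞ (d ⊗ y ⊞ ⊟ (d ⊗ y))       ≡⟨ cong₂ (λ a b → a ⊞ u ⊞ b) (W.identityˡ (c ⊗ x)) (W.inverseʳ (d ⊗ y)) ⟩
          (c ⊗ x ⊞ u) ⊞ 0W                             ≡⟨ W.identityʳ _ ⟩
          c ⊗ x ⊞ u                                    ∎

      -- A merged column forces x = y, so its count keeps only the diagonal terms; `f̂` and `ĝ`
      -- belong to independent x and y.
      T : Vec (Vec F n) m → ℕ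
      T u = ∑ allV (λ x → S x * (f u x * g u x))

      f̂ ĝ : Vec (Vec F n) m → ℕ
      f̂ u = ∑ allV (λ x → S x * f u x)
      ĝ u = ∑ allV (λ y → S y * g u y)

      merged : hist S ((c ⊕ d) ∷ L ++ R) 0W ≡ ∑ allW T
      merged = begin
        ∑ allV (λ x → S x * hist S (L ++ R) (0W ⊞ (c ⊕ d) ⊗ x))
          ≡⟨ ∑-cong allV (λ x → cong (λ z → S x * hist S (L ++ R) z) (trans (cong (0W ⊞_) (⊗-distribʳ c d x)) (sym (W.assoc 0W _ _)))) ⟩
        ∑ allV (λ x → S x * hist S (L ++ R) (0W ⊞ c ⊗ x ⊞ d ⊗ x))
          ≡⟨ ∑-cong allV (λ x → trans (cong (S x *_) (convolution x x)) (*-∑ allW (S x) _)) ⟩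
        ∑ allV (λ x → ∑ allW (λ u → S x * (f u x * g u x)))
          ≡⟨ ∑-swap allV allW _ ⟩
        ∑ allW T ∎
        where open ≡-Reasoning

      separated : hist S (c ∷ d ∷ L ++ R) 0W ≡ ∑ allW (λ u → f̂ u * ĝ u)
      separated = begin
        ∑ allV (λ x → S x * ∑ allV (λ y → S y * hist S (L ++ R) (0W ⊞ c ⊗ x ⊞ d ⊗ y)))
          ≡⟨ ∑-cong allV (λ x → cong (S x *_) (inner x)) ⟩
        ∑ allV (λ x → S x * ∑ allW (λ u → f u x * ĝ u))
          ≡⟨ ∑-cong allV (λ x → *-∑ allW (S x) _) ⟩
        ∑ allV (λ x → ∑ allW (λ u → S x * (f u x * ĝ u)))
          ≡⟨ ∑-swap allV allW _ ⟩
        ∑ allW (λ u → ∑ allV (λ x → S x * (f u x * ĝ u)))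
          ≡⟨ ∑-cong allW (λ u → trans (∑-cong allV (λ x → sym (*-assoc (S x) _ _))) (sym (∑-* allV (ĝ u) _))) ⟩
        ∑ allW (λ u → f̂ u * ĝ u) ∎
        where
        open ≡-Reasoning
        inner : ∀ x → ∑ allV (λ y → S y * hist S (L ++ R) (0W ⊞ c ⊗ x ⊞ d ⊗ y)) ≡ ∑ allW (λ u → f u x * ĝ u)
        inner x = begin
          ∑ allV (λ y → S y * hist S (L ++ R) (0W ⊞ c ⊗ x ⊞ d ⊗ y))
            ≡⟨ ∑-cong allV (λ y → trans (cong (S y *_) (convolution x y)) (*-∑ allW (S y) _)) ⟩
          ∑ allV (λ y → ∑ allW (λ u → S y * (f u x * g u y)))
            ≡⟨ ∑-swap allV allW _ ⟩
          ∑ allW (λ u → ∑ allV (λ y → S y * (f u x * g u y)))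
            ≡⟨ ∑-cong allW (λ u → trans (∑-cong allV (λ y → *-left-comm (S y) (f u x) (g u y))) (sym (*-∑ allV (f u x) _))) ⟩
          ∑ allW (λ u → f u x * ĝ u) ∎

      module _ (spanL : Spanning L) (spanR : Spanning R) where

        A B M : ℕ
        A = Q ^ length L
        B = Q ^ length R
        M = Q ^ m

        -- As R spans, `g` is at most `B / M` at every point.
        T≤f̂ : ∀ u → M * T u ≤ B * f̂ u
        T≤f̂ u = begin
          M * T u                                     ≡⟨ *-∑ allV M _ ⟩
          ∑ allV (λ x → M * (S x * (f u x * g u x)))  ≤⟨ ∑-mono allV at ⟩
          ∑ allV (λ x → B * (S x * f u x))            ≡⟨ *-∑ allV B _ ⟨
          B * f̂ u                                     ∎
          where
          open ℕₚ.≤-Reasoning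
          rearrange : ∀ a s b e → a * (s * (b * e)) ≡ s * b * (a * e)
          rearrange = solve-∀
          at : ∀ x → M * (S x * (f u x * g u x)) ≤ B * (S x * f u x)
          at x = begin
            M * (S x * (f u x * g u x))   ≡⟨ rearrange M (S x) (f u x) (g u x) ⟩
            S x * f u x * (M * g u x)     ≤⟨ *-monoʳ-≤ (S x * f u x) (hist-spanning S S≤1 R spanR _) ⟩
            S x * f u x * B               ≡⟨ *-comm _ B ⟩
            B * (S x * f u x)             ∎

        T≤ĝ : ∀ u → M * T u ≤ A * ĝ u
        T≤ĝ u = begin
          M * T u                                     ≡⟨ *-∑ allV M _ ⟩
          ∑ allV (λ x → M * (S x * (f u x * g u x)))  ≤⟨ ∑-mono allV at ⟩
          ∑ allV (λ x → A * (S x * g u x))            ≡⟨ *-∑ allV A _ ⟨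
          A * ĝ u                                     ∎
          where
          open ℕₚ.≤-Reasoning
          rearrange : ∀ a s b e → a * (s * (b * e)) ≡ s * e * (a * b)
          rearrange = solve-∀
          at : ∀ x → M * (S x * (f u x * g u x)) ≤ A * (S x * g u x)
          at x = begin
            M * (S x * (f u x * g u x))   ≡⟨ rearrange M (S x) (f u x) (g u x) ⟩
            S x * g u x * (M * f u x)     ≤⟨ *-monoʳ-≤ (S x * g u x) (hist-spanning S S≤1 L spanL _) ⟩
            S x * g u x * A               ≡⟨ *-comm _ A ⟩
            A * (S x * g u x)             ∎

        -- Cauchy–Schwarz over u, with T u ^ 2 ≤ (B / M) f̂ u · (A / M) ĝ u.
        splitting-inequality : M * (∑ allW T * ∑ allW T) ≤ A * B * ∑ allW (λ u → f̂ u * ĝ u)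
        splitting-inequality = ℕₚ.*-cancelˡ-≤ M {{Q^-nonZero m}} (begin
          M * (M * (∑ allW T * ∑ allW T))                 ≤⟨ *-monoʳ-≤ M (*-monoʳ-≤ M (cauchy-schwarz allW T)) ⟩
          M * (M * (length allW * ∑ allW (λ u → T u * T u)))
                                                          ≡⟨ cong (λ z → M * (M * (z * ∑ allW (λ u → T u * T u)))) length-allW ⟩
          M * (M * (M * ∑ allW (λ u → T u * T u)))        ≡⟨ cong (λ z → M * z) (trans (sym (*-assoc M M _)) (*-∑ allW (M * M) _)) ⟩
          M * ∑ allW (λ u → M * M * (T u * T u))          ≤⟨ *-monoʳ-≤ M (∑-mono allW at) ⟩
          M * ∑ allW (λ u → A * B * (f̂ u * ĝ u))          ≡⟨ cong (M *_) (*-∑ allW (A * B) _) ⟨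
          M * (A * B * ∑ allW (λ u → f̂ u * ĝ u))          ∎)
          where
          open ℕₚ.≤-Reasoning
          open Algebra.Properties.CommutativeSemigroup ℕₚ.*-commutativeSemigroup
            using () renaming (interchange to *-interchange)
          rearrange : ∀ a b x y → b * x * (a * y) ≡ a * b * (x * y)
          rearrange = solve-∀
          at : ∀ u → M * M * (T u * T u) ≤ A * B * (f̂ u * ĝ u)
          at u = begin
            M * M * (T u * T u)       ≡⟨ *-interchange M M (T u) (T u) ⟩
            M * T u * (M * T u)       ≤⟨ *-mono-≤ (T≤f̂ u) (T≤ĝ u) ⟩
            B * f̂ u * (A * ĝ u)       ≡⟨ rearrange A B (f̂ u) (ĝ u) ⟩
            A * B * (f̂ u * ĝ u)       ∎

        -- The hypothesis is squared, whence the doubled exponent, and `splitting-inequality` then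
        -- trades `M * (H * H)` for `C * H′`.
        dense-split : ∀ {e} → Dense e ((c ⊕ d) ∷ L ++ R) → Dense (e + e) (c ∷ d ∷ L ++ R)
        dense-split {e} dense = ℕₚ.*-cancelˡ-≤ C {{Q^-nonZero (length (L ++ R))}} (begin
          C * (σ ^ (e + e) * (Q * (Q * C)))     ≡⟨ cong (λ z → C * (z * (Q * (Q * C)))) (^-distribˡ-+-* σ e e) ⟩
          C * (s * s * (Q * (Q * C)))           ≡⟨ rearrange₁ C s Q ⟩
          s * (Q * C) * (s * (Q * C))           ≤⟨ *-mono-≤ dense dense ⟩
          H * (M * E) * (H * (M * E))           ≡⟨ rearrange₂ H M E ⟩
          M * (H * H) * (M * (E * E))           ≤⟨ *-monoˡ-≤ (M * (E * E)) energy ⟩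
          C * H′ * (M * (E * E))                ≡⟨ *-assoc C H′ _ ⟩
          C * (H′ * (M * (E * E)))              ≡⟨ cong (λ z → C * (H′ * (M * z))) (^-distribˡ-+-* Q e e) ⟨
          C * (H′ * (M * Q ^ (e + e)))          ∎)
          where
          open ℕₚ.≤-Reasoning
          C s E H H′ : ℕ
          C = Q ^ length (L ++ R)
          s = σ ^ e
          E = Q ^ e
          H = hist S ((c ⊕ d) ∷ L ++ R) 0W
          H′ = hist S (c ∷ d ∷ L ++ R) 0W
          rearrange₁ : ∀ C s Q → C * (s * s * (Q * (Q * C))) ≡ s * (Q * C) * (s * (Q * C))
          rearrange₁ = solve-∀
          rearrange₂ : ∀ H M E → H * (M * E) * (H * (M * E)) ≡ M * (H * H) * (M * (E * E))
          rearrange₂ = solve-∀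
          energy : M * (H * H) ≤ C * H′
          energy = begin
            M * (H * H)                                ≡⟨ cong (λ z → M * (z * z)) merged ⟩
            M * (∑ allW T * ∑ allW T)                  ≤⟨ splitting-inequality ⟩
            A * B * ∑ allW (λ u → f̂ u * ĝ u)           ≡⟨ cong₂ _*_ (trans (cong (Q ^_) (Listₚ.length-++ L)) (^-distribˡ-+-* Q (length L) (length R))) separated ⟨
            C * H′                                     ∎

-- Permutations of lists, and columns tagged with their blocks.

separate : {X : Set} (p : X → Bool) (xs : List X) → ∃[ L ] ∃[ R ] (xs ↭ L ++ R ×
  (∀ {x} → x ∈ xs → p x ≡ true → x ∈ L) × (∀ {x} → x ∈ xs → p x ≡ false → x ∈ R))
separate p [] = [] , [] , ↭.refl , (λ ()) , (λ ())
separate p (x ∷ xs) with separate p xs | p x in px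
... | L , R , π , inL , inR | true  = x ∷ L , R , ↭.prep x π ,
      (λ { (here refl) _ → here refl ; (there y∈) py → there (inL y∈ py) }) ,
      (λ { (here refl) py → contradiction (trans (sym px) py) λ () ; (there y∈) py → inR y∈ py })
... | L , R , π , inL , inR | false = L , x ∷ R , ↭-trans (↭.prep x π) (↭-sym (↭ₚ.shift x L R)) ,
      (λ { (here refl) py → contradiction (trans (sym px) py) λ () ; (there y∈) py → inL y∈ py }) ,
      (λ { (here refl) _ → here refl ; (there y∈) py → there (inR y∈ py) })

-- The entries of `is` are distinct, so r occurs once and the two mapped lists can differ in one
-- position only, which is moved to the front.
map-update : {I X : Set} (f g : I → X) {r : I} {is : List I} → Unique is → r ∈ is →
  (∀ i → r ≢ i → f i ≡ g i) →
  ∃[ rest ] (List.map f is ↭ f r ∷ rest × List.map g is ↭ g r ∷ rest)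
map-update f g {r} {_ ∷ is} (r∉ AllPairs.∷ _) (here refl) f≗g =
  List.map f is , ↭.refl , ↭.prep (g r) (↭-reflexive (sym (map-cong-∈ is r∉)))
  where
  map-cong-∈ : ∀ is → All.All (r ≢_) is → List.map f is ≡ List.map g is
  map-cong-∈ []       All.[]         = refl
  map-cong-∈ (i ∷ is) (r≢i All.∷ r∉) = cong₂ _∷_ (f≗g i r≢i) (map-cong-∈ is r∉)
map-update f g {r} {i ∷ is} (i∉ AllPairs.∷ uniq) (there r∈) f≗g with map-update f g uniq r∈ f≗g
... | rest , πf , πg = f i ∷ rest ,
      ↭-trans (↭.prep (f i) πf) (↭.swap (f i) (f r) ↭.refl) ,
      ↭-trans (↭-reflexive (cong (_∷ List.map g is) (sym (f≗g i (≢-sym (All.lookup i∉ r∈))))))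
        (↭-trans (↭.prep (f i) πg) (↭.swap (f i) (g r) ↭.refl))

-- Splitting off a column costs a Cauchy–Schwarz step, which squares the density: t columns turn e into 2 ^ t * e.
doubled : ℕ → ℕ → ℕ
doubled zero    e = e
doubled (suc t) e = doubled t (e ℕ.+ e)

module Tagged {q : ℕ} (𝔽 : FiniteField q) {m N : ℕ} where

  open FiniteField 𝔽
  open Linear 𝔽

  Item : Set
  Item = Fin N × Vec F m

  blockSum : List Item → Fin N → Vec F m
  blockSum []            r = 0V
  blockSum ((i , c) ∷ T) r = if does (i Finₚ.≟ r) then c ⊕ blockSum T r else blockSum T r

  blockSum-same : ∀ i c T → blockSum ((i , c) ∷ T) i ≡ c ⊕ blockSum T i
  blockSum-same i c T with i Finₚ.≟ i
  ... | yes _  = refl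
  ... | no i≢i = contradiction refl i≢i

  blockSum-other : ∀ {i r} c T → i ≢ r → blockSum ((i , c) ∷ T) r ≡ blockSum T r
  blockSum-other {i} {r} c T i≢r with i Finₚ.≟ r
  ... | yes i≡r = contradiction i≡r i≢r
  ... | no _    = refl

  -- Stated for an additive φ so as to cover both the coordinates of a block sum and its values
  -- under functionals.
  blockSum-tabulate : ∀ {k} (φ : Vec F m → F) → φ 0V ≡ 0# → (∀ c d → φ (c ⊕ d) ≡ φ c + φ d) →
    (g : Fin k → Item) (r : Fin N) →
    φ (blockSum (List.tabulate g) r) ≡ ΣOver (λ j → does (proj₁ (g j) Finₚ.≟ r)) (φ ∘ proj₂ ∘ g)
  blockSum-tabulate {zero}  φ φ0 φ+ g r = φ0
  blockSum-tabulate {suc k} φ φ0 φ+ g r with does (proj₁ (g Fin.zero) Finₚ.≟ r) | blockSum-tabulate φ φ0 φ+ (g ∘ Fin.suc) r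
  ... | true  | ih = trans (φ+ _ _) (cong (_ +_) ih)
  ... | false | ih = trans ih (sym (R.+-identityˡ _))

-- Refining the blocks into single columns.

module Refining {q : ℕ} (𝔽 : FiniteField q) (finiteF : Finite (FiniteField.F 𝔽)) (n m : ℕ)
  (S : Vec (FiniteField.F 𝔽) n → ℕ) (S≤1 : ∀ x → S x ℕ.≤ 1)
  {N : ℕ} (side : Fin N → Bool) (b : Fin N → Vec (FiniteField.F 𝔽) m)
  (rigid : ∀ β r₀ l → (∀ r → side r ≡ β → r ≢ r₀ → Linear.dot 𝔽 l (b r) ≡ FiniteField.0# 𝔽) → l ≡ Linear.0V 𝔽)
  (tags : List (Fin N)) (tags-unique : Unique tags) (tags-complete : ∀ r → r ∈ tags)
  where

  open FiniteField 𝔽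
  open Linear 𝔽
  open Counting 𝔽 finiteF n m using (module Density)
  open Density S S≤1
  open Tagged 𝔽 {m} {N}

  columns : List Item → List (Vec F m)
  columns = List.map proj₂

  -- The dual form of `b r` lying in the span of the columns tagged r. The vectors `b r` stay fixed
  -- while items are split, which makes this the invariant of the refinement.
  Controls : List Item → Set
  Controls Z = ∀ l r → (∀ {c} → (r , c) ∈ Z → dot l c ≡ 0#) → dot l (b r) ≡ 0#

  controls-↭ : ∀ {Z Z′} → Z ↭ Z′ → Controls Z → Controls Z′
  controls-↭ π ctl l r kills = ctl l r (kills ∘ ↭ₚ.∈-resp-↭ π)

  controls-split : ∀ {r c d Z} → Controls ((r , c ⊕ d) ∷ Z) → Controls ((r , c) ∷ (r , d) ∷ Z)
  controls-split {r} {c} {d} ctl l r′ kills = ctl l r′ λ where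
    (here refl) → trans (dot-⊕ l c d)
      (trans (cong₂ _+_ (kills (here refl)) (kills (there (here refl))))
             (R.+-identityˡ 0#))
    (there c∈)  → kills (there (there c∈))

  dense-columns-↭ : ∀ {e Z Z′} → Z ↭ Z′ → Dense e (columns Z) → Dense e (columns Z′)
  dense-columns-↭ {e} π = dense-↭ {e} (↭ₚ.map⁺ proj₂ π)

  -- The other items are sorted by side. They control every block except possibly r, whose split
  -- item is set aside, and `rigid` tolerates one missing block.
  dense-split-item : ∀ {e r c d Z} → Controls ((r , c ⊕ d) ∷ Z) →
    Dense e (columns ((r , c ⊕ d) ∷ Z)) → Dense (e ℕ.+ e) (columns ((r , c) ∷ (r , d) ∷ Z))
  dense-split-item {e} {r} {c} {d} {Z} ctl dense with separate (side ∘ proj₁) Z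
  ... | L , R , π , inL , inR =
    dense-↭ {e ℕ.+ e} (↭.prep c (↭.prep d (↭-sym π′)))
      (Splitting.dense-split c d (columns L) (columns R)
        (spans true L inL) (spans false R inR) {e} (dense-↭ {e} (↭.prep (c ⊕ d) π′) dense))
    where
    π′ : columns Z ↭ columns L ++ columns R
    π′ = ↭-trans (↭ₚ.map⁺ proj₂ π) (↭-reflexive (Listₚ.map-++ proj₂ L R))
    spans : ∀ β Y → (∀ {x} → x ∈ Z → side (proj₁ x) ≡ β → x ∈ Y) → Spanning (columns Y)
    spans β Y inY l kills = rigid β r l λ r′ side≡ r′≢r → ctl l r′ λ where
      (here refl) → contradiction refl r′≢r
      (there c∈)  → kills (∈-map⁺ proj₂ (inY c∈ side≡))

  -- What remains of each block while the columns in T are still unsplit; an exhausted block is kept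
  -- as a zero column.
  blocks : List Item → List Item
  blocks T = List.map (λ r → r , blockSum T r) tags

  dense-drop-empty : ∀ {e} D → Dense e (columns (D ++ blocks [])) → Dense e (columns D)
  dense-drop-empty {e} D dense = drop tags (dense-columns-↭ {e} (↭ₚ.++-comm D (blocks [])) dense)
    where
    drop : ∀ rs → Dense e (columns (List.map (λ r → r , 0V) rs ++ D)) → Dense e (columns D)
    drop []       p = p
    drop (r ∷ rs) p = drop rs (dense-zero {e} {columns (List.map (λ r → r , 0V) rs ++ D)} p)

  -- D holds the columns already split off their blocks.
  dense-refine : ∀ T D {e} → Controls (D ++ blocks T) → Dense e (columns (D ++ blocks T)) →
    Dense (doubled (length T) e) (columns (D ++ T))
  dense-refine [] D {e} ctl dense =
    subst (Dense e ∘ columns) (sym (Listₚ.++-identityʳ D)) (dense-drop-empty {e} D dense)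
  dense-refine ((r , c) ∷ T) D {e} ctl dense
    -- Moving `(r , c)` from T to D changes the remainder of block r only, from `c ⊕ blockSum T r`
    -- to `blockSum T r`.
    with map-update (λ i → i , blockSum ((r , c) ∷ T) i) (λ i → i , blockSum T i) tags-unique (tags-complete r)
           (λ i r≢i → cong (i ,_) (blockSum-other c T r≢i))
  ... | rest , πf , πg =
    dense-columns-↭ {doubled (length T) (e ℕ.+ e)} (↭-sym (↭ₚ.shift (r , c) D T))
      (dense-refine T ((r , c) ∷ D) {e ℕ.+ e}
        (controls-↭ after (controls-split ctl′))
        (dense-columns-↭ {e ℕ.+ e} after (dense-split-item {e} ctl′ (dense-columns-↭ {e} before dense))))
    where
    before : D ++ blocks ((r , c) ∷ T) ↭ (r , c ⊕ blockSum T r) ∷ D ++ rest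
    before = ↭-trans (↭ₚ.++⁺ˡ D πf)
      (↭-trans (↭-reflexive (cong (λ x → D ++ (r , x) ∷ rest) (blockSum-same r c T)))
               (↭ₚ.shift (r , c ⊕ blockSum T r) D rest))
    after : (r , c) ∷ (r , blockSum T r) ∷ D ++ rest ↭ (r , c) ∷ D ++ blocks T
    after = ↭.prep (r , c) (↭-trans (↭-sym (↭ₚ.shift (r , blockSum T r) D rest)) (↭ₚ.++⁺ˡ D (↭-sym πg)))
    ctl′ : Controls ((r , c ⊕ blockSum T r) ∷ D ++ rest)
    ctl′ = controls-↭ before ctl

-- The columns of the matrix and full row rank.

module Columns {q : ℕ} (𝔽 : FiniteField q) {m k : ℕ} (A : FiniteField.Matrix 𝔽 m k) where

  open FiniteField 𝔽
  open Linear 𝔽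

  column : Fin k → Vec F m
  column j = Vec.tabulate (λ i → A i j)

  columnList : List (Vec F m)
  columnList = List.tabulate column

  FullRowRank : Set
  FullRowRank = ∀ λs → (∀ j → rowComb A λs j ≡ 0#) → ∀ i → λs i ≡ 0#

  dot-column : ∀ l j → dot l (column j) ≡ rowComb A (Vec.lookup l) j
  dot-column l j = Σ-cong λ i → cong (Vec.lookup l i *_) (lookup∘tabulate (λ i → A i j) i)

  fullRowRank⇒≡0 : FullRowRank → ∀ l → (∀ j → dot l (column j) ≡ 0#) → l ≡ 0V
  fullRowRank⇒≡0 full l kills = lookup⇒≡0V l (full (Vec.lookup l) λ j → trans (sym (dot-column l j)) (kills j))

  columnList-spanning : FullRowRank → Spanning columnList
  columnList-spanning full l kills = fullRowRank⇒≡0 full l λ j → kills (∈-tabulate⁺ j)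

-- The blocks of the partition under conditions (i) and (ii).

module Blocks {q : ℕ} (𝔽 : FiniteField q) {m k : ℕ} (A : FiniteField.Matrix 𝔽 m k)
  (s : ℕ) (part : Fin k → Fin (s ℕ.+ s))
  (full : Columns.FullRowRank 𝔽 A)
  (condI : FiniteField.CondI 𝔽 A s part) (condII : FiniteField.CondII 𝔽 A s part) where

  open FiniteField 𝔽
  open Linear 𝔽
  open Columns 𝔽 A
  open Tagged 𝔽 {m} {s ℕ.+ s}

  item : Fin k → Item
  item j = part j , column j

  items : List Item
  items = List.tabulate item

  b : Fin (s ℕ.+ s) → Vec F m
  b = blockSum items

  left right : Fin s → Fin (s ℕ.+ s)
  left r = r ↑ˡ s
  right r = s ↑ʳ r

  left≢right : ∀ {r t} → left r ≢ right t
  left≢right {r} {t} e =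
    contradiction (trans (sym (Finₚ.splitAt-↑ˡ s r s)) (trans (cong (splitAt s) e) (Finₚ.splitAt-↑ʳ s s t))) λ ()

  disjoint : ∀ r j → P A s part r j ≡ true → P' A s part r j ≡ false
  disjoint r j p with part j Finₚ.≟ left r | part j Finₚ.≟ right r
  ... | yes e | yes e′ = contradiction (trans (sym e) e′) left≢right
  ... | yes e | no _   = refl

  -- Condition (i), read row by row.
  opposite : ∀ r → b (left r) ⊕ b (right r) ≡ 0V
  opposite r = lookup⇒≡0V _ λ i → begin
    Vec.lookup (b (left r) ⊕ b (right r)) i
      ≡⟨ lookup-zipWith _+_ i (b (left r)) (b (right r)) ⟩
    Vec.lookup (b (left r)) i + Vec.lookup (b (right r)) i
      ≡⟨ cong₂ _+_ (entry i (left r)) (entry i (right r)) ⟩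
    ΣOver (P A s part r) (A i) + ΣOver (P' A s part r) (A i)
      ≡⟨ ΣOver-∪ _ _ (disjoint r) (A i) ⟩
    ΣOver (λ j → if P A s part r j then true else P' A s part r j) (A i)
      ≡⟨ condI r i ⟩
    0# ∎
    where
    open ≡-Reasoning
    entry : ∀ i t → Vec.lookup (b t) i ≡ ΣOver (inBlock A s part t) (A i)
    entry i t = trans
      (blockSum-tabulate (λ v → Vec.lookup v i) (lookup-replicate i 0#) (lookup-zipWith _+_ i) item t)
      (ΣOver-cong (inBlock A s part t) λ j → lookup∘tabulate (λ i → A i j) i)

  dot-b : ∀ l t → dot l (b t) ≡ ΣOver (inBlock A s part t) (rowComb A (Vec.lookup l))
  dot-b l t = trans
    (blockSum-tabulate (dot l) (dot-zeroʳ l) (dot-⊕ l) item t)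
    (ΣOver-cong (inBlock A s part t) (dot-column l))

  dot-left : ∀ l r → dot l (b (right r)) ≡ 0# → dot l (b (left r)) ≡ 0#
  dot-left l r e = begin
    dot l (b (left r))                        ≡⟨ R.+-identityʳ _ ⟨
    dot l (b (left r)) + 0#                   ≡⟨ cong (dot l (b (left r)) +_) e ⟨
    dot l (b (left r)) + dot l (b (right r))  ≡⟨ dot-⊕ l (b (left r)) (b (right r)) ⟨
    dot l (b (left r) ⊕ b (right r))          ≡⟨ cong (dot l) (opposite r) ⟩
    dot l 0V                                  ≡⟨ dot-zeroʳ l ⟩
    0#                                        ∎
    where open ≡-Reasoning

  side : Fin (s ℕ.+ s) → Bool
  side t = [ (λ _ → true) , (λ _ → false) ]′ (splitAt s t)

  -- By (ii) a nonzero row combination has nonzero sum over two of the blocks `P_r`, and r₀ excludes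
  -- at most one of them. The argument `tag` lets the excluded block lie on either side.
  rigid-by : (tag : Fin s → Fin (s ℕ.+ s)) → (∀ {r t} → tag r ≡ tag t → r ≡ t) →
    ∀ r₀ l → (∀ r → tag r ≢ r₀ → dot l (b (left r)) ≡ 0#) → l ≡ 0V
  rigid-by tag tag-injective r₀ l kills = fullRowRank⇒≡0 full l λ j →
    decidable-stable (dot l (column j) ≟F 0#) λ nz → absurd j (nz ∘ trans (dot-column l j))
    where
    zero-on : ∀ r → tag r ≢ r₀ → ΣOver (P A s part r) (rowComb A (Vec.lookup l)) ≡ 0#
    zero-on r ne = trans (sym (dot-b l (left r))) (kills r ne)
    absurd : ∀ j → rowComb A (Vec.lookup l) j ≢ 0# → ⊥
    absurd j nz with condII (Vec.lookup l) (j , nz)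
    ... | r₁ , r₂ , r₁≢r₂ , nz₁ , nz₂ with tag r₁ Finₚ.≟ r₀
    ... | no ne = nz₁ (zero-on r₁ ne)
    ... | yes e = nz₂ (zero-on r₂ λ e′ → r₁≢r₂ (tag-injective (trans e (sym e′))))

  rigid : ∀ β r₀ l → (∀ r → side r ≡ β → r ≢ r₀ → dot l (b r) ≡ 0#) → l ≡ 0V
  rigid true r₀ l kills = rigid-by left (Finₚ.↑ˡ-injective s _ _) r₀ l λ r →
    kills (left r) (cong [ _ , _ ]′ (Finₚ.splitAt-↑ˡ s r s))
  rigid false r₀ l kills = rigid-by right (Finₚ.↑ʳ-injective s _ _) r₀ l λ r ne →
    dot-left l r (kills (right r) (cong [ _ , _ ]′ (Finₚ.splitAt-↑ʳ s s r)) ne)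

  tags : List (Fin (s ℕ.+ s))
  tags = List.map left (allFin s) ++ List.map right (allFin s)

  tags-unique : Unique tags
  tags-unique = Uniqueₚ.++⁺
    (Uniqueₚ.map⁺ (Finₚ.↑ˡ-injective s _ _) (Uniqueₚ.allFin⁺ s))
    (Uniqueₚ.map⁺ (Finₚ.↑ʳ-injective s _ _) (Uniqueₚ.allFin⁺ s))
    disjoint-tags
    where
    disjoint-tags : ∀ {t} → ¬ (t ∈ List.map left (allFin s) × t ∈ List.map right (allFin s))
    disjoint-tags (t∈ , t∈′) with ∈-map⁻ left t∈ | ∈-map⁻ right t∈′
    ... | _ , _ , e | _ , _ , e′ = left≢right (trans (sym e) e′)

  tags-complete : ∀ t → t ∈ tags
  tags-complete t with splitAt s t in eq
  ... | inj₁ r = ∈-++⁺ˡ (subst (_∈ _) (Finₚ.splitAt⁻¹-↑ˡ eq) (∈-map⁺ left (∈-allFin r)))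
  ... | inj₂ r = ∈-++⁺ʳ _ (subst (_∈ _) (Finₚ.splitAt⁻¹-↑ʳ eq) (∈-map⁺ right (∈-allFin r)))

  -- This is 2 ^ k * 2s: the block sums start with s + s, and each of the k columns doubles it. It
  -- does not depend on n.
  exponent : ℕ
  exponent = doubled k (s ℕ.+ s)

  module _ (finiteF : Finite F) (n : ℕ) (S : Vec F n → ℕ) (S≤1 : ∀ x → S x ℕ.≤ 1) where

    open Counting 𝔽 finiteF n m using (module Density)
    open Density S S≤1
    open Refining 𝔽 finiteF n m S S≤1 side b rigid tags tags-unique tags-complete

    -- By `opposite` the block sums of the second half are the negatives of those of the first,
    -- which is the shape treated by `dense-base`.
    dense-blocks : Dense (s ℕ.+ s) (columns (blocks items))
    dense-blocks = subst₂ Dense (cong₂ ℕ._+_ length-lefts length-lefts) (sym columns≡) (dense-base lefts)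
      where
      lefts : List (Vec F m)
      lefts = List.map (b ∘ left) (allFin s)
      length-lefts : length lefts ≡ s
      length-lefts = trans (Listₚ.length-map (b ∘ left) (allFin s)) (Listₚ.length-tabulate (λ i → i))
      columns≡ : columns (blocks items) ≡ lefts ++ List.map ⊝_ lefts
      columns≡ = begin
        columns (blocks items)                ≡⟨ Listₚ.map-∘ tags ⟨
        List.map b tags                       ≡⟨ Listₚ.map-++ b (List.map left (allFin s)) _ ⟩
        List.map b (List.map left (allFin s)) ++ List.map b (List.map right (allFin s))
          ≡⟨ cong₂ _++_ (Listₚ.map-∘ (allFin s)) (Listₚ.map-∘ (allFin s)) ⟨
        lefts ++ List.map (b ∘ right) (allFin s)
          ≡⟨ cong (lefts ++_) (Listₚ.map-cong (λ r → inverseʳ-unique _ _ (opposite r)) (allFin s)) ⟩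
        lefts ++ List.map (⊝_ ∘ b ∘ left) (allFin s)
          ≡⟨ cong (lefts ++_) (Listₚ.map-∘ (allFin s)) ⟩
        lefts ++ List.map ⊝_ lefts            ∎
        where
        open ≡-Reasoning
        open Algebra.Properties.Group (AbelianGroup.group (groupV m)) using (inverseʳ-unique)

    dense-columnList : Dense exponent columnList
    dense-columnList = subst₂ Dense (cong (λ t → doubled t (s ℕ.+ s)) (Listₚ.length-tabulate item))
      (Listₚ.map-tabulate item proj₂)
      (dense-refine items [] {s ℕ.+ s}
        -- At the start each block is a single item equal to its own sum, so it controls itself.
        (λ l r kills → kills (∈-map⁺ (λ r → r , b r) (tags-complete r))) dense-blocks)

-- Bernoulli's inequality and the choice of the growth rate.

module Arithmetic where

  open import Data.Nat using (_+_; _*_; _^_; _≤_; _<_; z≤n; s≤s)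
  open ℕₚ

  -- (1 − 1/N)^i ≥ 1 − i/N, for N = suc d and r = N − i.
  bernoulli : ∀ d i r → i + r ≡ suc d → suc d ^ i * r ≤ d ^ i * suc d
  bernoulli d zero    r e = ≤-reflexive (cong (1 *_) e)
  bernoulli d (suc i) r e = begin
    N * N ^ i * r          ≡⟨ rearrange N (N ^ i) r ⟩
    N ^ i * (r + d * r)    ≤⟨ *-monoʳ-≤ (N ^ i) (+-monoˡ-≤ (d * r) r≤d) ⟩
    N ^ i * (d + d * r)    ≡⟨ rearrange′ (N ^ i) d r ⟩
    d * (N ^ i * suc r)    ≤⟨ *-monoʳ-≤ d (bernoulli d i (suc r) (trans (+-suc i r) e)) ⟩
    d * (d ^ i * N)        ≡⟨ *-assoc d (d ^ i) N ⟨
    d * d ^ i * N          ∎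
    where
    open ≤-Reasoning
    N : ℕ
    N = suc d
    r≤d : r ≤ d
    r≤d = ≤-trans (m≤n+m r i) (≤-reflexive (suc-injective e))
    rearrange : ∀ N a r → N * a * r ≡ a * (N * r)
    rearrange = solve-∀
    rearrange′ : ∀ a d r → a * (d + d * r) ≡ d * (a * suc r)
    rearrange′ = solve-∀

  -- `bernoulli` with N = 2e and i = r = e, where e = E + 1: it says (1 - 1/N) ^ e ≥ 1/2.
  bernoulli-half : ∀ E → suc (suc (E + E)) ^ suc E ≤ 2 * suc (E + E) ^ suc E
  bernoulli-half E = *-cancelʳ-≤ _ _ (suc E) (begin
    suc (suc (E + E)) ^ suc E * suc E            ≤⟨ bernoulli (suc (E + E)) (suc E) (suc E) (cong suc (+-suc E E)) ⟩
    suc (E + E) ^ suc E * suc (suc (E + E))      ≡⟨ rearrange (suc (E + E) ^ suc E) E ⟩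
    2 * suc (E + E) ^ suc E * suc E              ∎)
    where
    open ≤-Reasoning
    rearrange : ∀ a E → a * suc (suc (E + E)) ≡ 2 * a * suc E
    rearrange = solve-∀

  ^-distribʳ-* : ∀ a b n → (a * b) ^ n ≡ a ^ n * b ^ n
  ^-distribʳ-* a b zero    = refl
  ^-distribʳ-* a b (suc n) =
    trans (cong (a * b *_) (^-distribʳ-* a b n)) (rearrange a b (a ^ n) (b ^ n))
    where
    rearrange : ∀ a b x y → a * b * (x * y) ≡ a * x * (b * y)
    rearrange = solve-∀

  ^-comm : ∀ a m n → (a ^ m) ^ n ≡ (a ^ n) ^ m
  ^-comm a m n = trans (^-*-assoc a m n) (trans (cong (a ^_) (*-comm m n)) (sym (^-*-assoc a n m)))

  -- Write δ = σ / q ^ n, e = E + 1 and d / N = 1 - 1/(2e). The hypotheses say q ^ n δ ^ e ≤ K and δ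
  -- ≥ (K + 1)(d / N) ^ n. Since (d / N) ^ e ≥ 1/2 ≥ 1/q, they would give (K + 1) ^ e ≤ K.
  density-contradiction : ∀ {q} → 2 ≤ q → ∀ K E n σ →
    q ^ n * σ ^ suc E ≤ K * (q ^ n) ^ suc E →
    ¬ (suc K * (q * suc (E + E)) ^ n ≤ σ * suc (suc (E + E)) ^ n)
  density-contradiction {q} 2≤q K E n σ few dense =
    <⇒≱ (n<1+n K) (≤-trans (m≤m*n (suc K) (suc K ^ E) {{m^n≢0 (suc K) E}})
      (*-cancelʳ-≤ _ _ (Q * X ^ e) {{m*n≢0 Q (X ^ e) {{m^n≢0 q n}} {{m^n≢0 X e {{X≢0}}}}}} (begin
        suc K ^ e * (Q * X ^ e)             ≡⟨ rearrange (suc K ^ e) Q (X ^ e) ⟩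
        Q * (suc K ^ e * X ^ e)             ≡⟨ cong (Q *_) (^-distribʳ-* (suc K) X e) ⟨
        Q * (suc K * X) ^ e                 ≤⟨ *-monoʳ-≤ Q (^-monoˡ-≤ e dense) ⟩
        Q * (σ * N ^ n) ^ e                 ≡⟨ cong (Q *_) (^-distribʳ-* σ (N ^ n) e) ⟩
        Q * (σ ^ e * (N ^ n) ^ e)           ≡⟨ *-assoc Q _ _ ⟨
        Q * σ ^ e * (N ^ n) ^ e             ≤⟨ *-monoˡ-≤ _ few ⟩
        K * Q ^ e * (N ^ n) ^ e             ≡⟨ *-assoc K _ _ ⟩
        K * (Q ^ e * (N ^ n) ^ e)           ≤⟨ *-monoʳ-≤ K growth ⟩
        K * (Q * X ^ e)                     ∎)))
    where
    open ≤-Reasoning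
    e d N Q X : ℕ
    e = suc E
    d = suc (E + E)
    N = suc d
    Q = q ^ n
    X = (q * d) ^ n
    instance
      q≢0 : ℕ.NonZero q
      q≢0 = ℕ.>-nonZero (≤-trans (s≤s z≤n) 2≤q)
    X≢0 : ℕ.NonZero X
    X≢0 = m^n≢0 (q * d) n {{m*n≢0 q d}}
    rearrange : ∀ a b c → a * (b * c) ≡ b * (a * c)
    rearrange = solve-∀
    growth : Q ^ e * (N ^ n) ^ e ≤ Q * X ^ e
    growth = begin
      Q ^ e * (N ^ n) ^ e           ≡⟨ cong (Q ^ e *_) (^-comm N n e) ⟩
      Q ^ e * (N ^ e) ^ n           ≤⟨ *-monoʳ-≤ (Q ^ e) (^-monoˡ-≤ n (≤-trans (bernoulli-half E) (*-monoˡ-≤ (d ^ e) 2≤q))) ⟩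
      Q ^ e * (q * d ^ e) ^ n       ≡⟨ cong (Q ^ e *_) (^-distribʳ-* q (d ^ e) n) ⟩
      Q ^ e * (Q * (d ^ e) ^ n)     ≡⟨ rearrange (Q ^ e) Q _ ⟩
      Q * (Q ^ e * (d ^ e) ^ n)     ≡⟨ cong (λ z → Q * (Q ^ e * z)) (^-comm d e n) ⟩
      Q * (Q ^ e * (d ^ n) ^ e)     ≡⟨ cong (Q *_) (^-distribʳ-* Q (d ^ n) e) ⟨
      Q * (Q * d ^ n) ^ e           ≡⟨ cong (λ z → Q * z ^ e) (^-distribʳ-* q d n) ⟨
      Q * X ^ e                     ∎

-- Turning rational inequalities into inequalities of natural numbers.

module Fractions where

  -- The denominator is `suc d`, hence never zero; `frac a 0` is the integer a.
  frac : ℕ → ℕ → ℚ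
  frac a d = (ℤ.+ a) ℚ./ suc d

  toℚᵘ-frac : ∀ a d → ℚ.toℚᵘ (frac a d) ℚᵘ.≃ mkℚᵘ (ℤ.+ a) d
  toℚᵘ-frac a d = ℚₚ.toℚᵘ-fromℚᵘ (mkℚᵘ (ℤ.+ a) d)

  toℚᵘ-frac-* : ∀ a d b e → ℚ.toℚᵘ (frac a d ℚ.* frac b e) ℚᵘ.≃ mkℚᵘ (ℤ.+ a) d ℚᵘ.* mkℚᵘ (ℤ.+ b) e
  toℚᵘ-frac-* a d b e = ℚᵘₚ.≃-trans (ℚₚ.toℚᵘ-homo-* (frac a d) (frac b e))
    (ℚᵘₚ.*-cong (toℚᵘ-frac a d) (toℚᵘ-frac b e))

  frac-*-cancel : ∀ a d b → frac a d ℚ.* frac (suc d ℕ.* b) 0 ≡ frac (a ℕ.* b) 0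
  frac-*-cancel a d b = ℚₚ.toℚᵘ-injective (ℚᵘₚ.≃-trans (toℚᵘ-frac-* a d (suc d ℕ.* b) 0)
    (ℚᵘₚ.≃-trans (ℚᵘ.*≡* eq) (ℚᵘₚ.≃-sym (toℚᵘ-frac (a ℕ.* b) 0))))
    where
    rearrange : ∀ a d b → a ℕ.* (suc d ℕ.* b) ℕ.* 1 ≡ a ℕ.* b ℕ.* (suc d ℕ.* 1)
    rearrange = solve-∀
    eq : (ℤ.+ a) ℤ.* (ℤ.+ (suc d ℕ.* b)) ℤ.* (ℤ.+ 1) ≡ (ℤ.+ (a ℕ.* b)) ℤ.* (ℤ.+ (suc d ℕ.* 1))
    eq = begin
      (ℤ.+ a) ℤ.* (ℤ.+ (suc d ℕ.* b)) ℤ.* (ℤ.+ 1)  ≡⟨ cong (ℤ._* (ℤ.+ 1)) (ℤₚ.pos-* a (suc d ℕ.* b)) ⟨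
      (ℤ.+ (a ℕ.* (suc d ℕ.* b))) ℤ.* (ℤ.+ 1)      ≡⟨ ℤₚ.pos-* (a ℕ.* (suc d ℕ.* b)) 1 ⟨
      ℤ.+ (a ℕ.* (suc d ℕ.* b) ℕ.* 1)              ≡⟨ cong ℤ.+_ (rearrange a d b) ⟩
      ℤ.+ (a ℕ.* b ℕ.* (suc d ℕ.* 1))              ≡⟨ ℤₚ.pos-* (a ℕ.* b) (suc d ℕ.* 1) ⟩
      (ℤ.+ (a ℕ.* b)) ℤ.* (ℤ.+ (suc d ℕ.* 1))      ∎
      where open ≡-Reasoning

  frac-* : ∀ a b → frac a 0 ℚ.* frac b 0 ≡ frac (a ℕ.* b) 0
  frac-* a b = trans (cong (λ z → frac a 0 ℚ.* frac z 0) (sym (ℕₚ.*-identityˡ b))) (frac-*-cancel a 0 b)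

  frac-cancel-≤ : ∀ a b → frac a 0 ℚ.≤ frac b 0 → a ℕ.≤ b
  frac-cancel-≤ a b le = ℤₚ.drop‿+≤+ (subst₂ ℤ._≤_ (ℤₚ.*-identityʳ (ℤ.+ a)) (ℤₚ.*-identityʳ (ℤ.+ b))
    (ℚᵘₚ.drop-*≤* (ℚᵘₚ.≤-respˡ-≃ (toℚᵘ-frac a 0) (ℚᵘₚ.≤-respʳ-≃ (toℚᵘ-frac b 0) (ℚₚ.toℚᵘ-mono-≤ le)))))

  frac-positive : ∀ a d → .{{ℕ.NonZero a}} → ℚ.Positive (frac a d)
  frac-positive a d = ℚₚ.normalize-pos a (suc d)

  frac-< : ∀ a d b → a ℕ.< b ℕ.* suc d → frac a d ℚ.< frac b 0
  frac-< a d b lt = ℚₚ.toℚᵘ-cancel-<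
    (ℚᵘₚ.<-respˡ-≃ (ℚᵘₚ.≃-sym (toℚᵘ-frac a d)) (ℚᵘₚ.<-respʳ-≃ (ℚᵘₚ.≃-sym (toℚᵘ-frac b 0)) (ℚᵘ.*<*
      (subst₂ ℤ._<_ (sym (ℤₚ.*-identityʳ (ℤ.+ a))) (ℤₚ.pos-* b (suc d)) (ℤ.+<+ lt)))))

  module _ (γ : ℚ) (pow : ℕ → ℚ) (pow-zero : pow 0 ≡ 1ℚ) (pow-suc : ∀ n → pow (suc n) ≡ γ ℚ.* pow n) where

    -- Each factor γ is paired with one factor `suc d`, so no power has to be brought to lowest
    -- terms.
    pow-frac : ∀ a d → γ ≡ frac a d → ∀ n → pow n ℚ.* frac (suc d ℕ.^ n) 0 ≡ frac (a ℕ.^ n) 0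
    pow-frac a d γ≡ zero    = trans (cong (ℚ._* frac 1 0) pow-zero) (ℚₚ.*-identityˡ (frac 1 0))
    pow-frac a d γ≡ (suc n) = begin
      pow (suc n) ℚ.* frac (N ℕ.* N ℕ.^ n) 0             ≡⟨ cong₂ ℚ._*_ (trans (pow-suc n) (cong (ℚ._* pow n) γ≡)) (sym (frac-* N (N ℕ.^ n))) ⟩
      frac a d ℚ.* pow n ℚ.* (frac N 0 ℚ.* frac (N ℕ.^ n) 0)
                                                         ≡⟨ interchange (frac a d) (pow n) (frac N 0) (frac (N ℕ.^ n) 0) ⟩
      frac a d ℚ.* frac N 0 ℚ.* (pow n ℚ.* frac (N ℕ.^ n) 0)
                                                         ≡⟨ cong₂ ℚ._*_ cancel (pow-frac a d γ≡ n) ⟩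
      frac a 0 ℚ.* frac (a ℕ.^ n) 0                      ≡⟨ frac-* a (a ℕ.^ n) ⟩
      frac (a ℕ.* a ℕ.^ n) 0                             ∎
      where
      open ≡-Reasoning
      open Algebra.Properties.CommutativeSemigroup
        (CommutativeRing.*-commutativeSemigroup ℚₚ.+-*-commutativeRing) using (interchange)
      N : ℕ
      N = suc d
      cancel : frac a d ℚ.* frac N 0 ≡ frac a 0
      cancel = trans (cong (λ z → frac a d ℚ.* frac z 0) (sym (ℕₚ.*-identityʳ N)))
        (trans (frac-*-cancel a d 1) (cong (λ z → frac z 0) (ℕₚ.*-identityʳ a)))

    clear-denominators : ∀ a d → γ ≡ frac a d → ∀ B n σ →
      frac B 0 ℚ.* pow n ℚ.≤ frac σ 0 → B ℕ.* a ℕ.^ n ℕ.≤ σ ℕ.* suc d ℕ.^ n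
    clear-denominators a d γ≡ B n σ le = frac-cancel-≤ _ _
      (subst₂ ℚ._≤_ lhs (frac-* σ D) (ℚₚ.*-monoʳ-≤-nonNeg (frac D 0) {{ℚₚ.normalize-nonNeg D 1}} le))
      where
      D : ℕ
      D = suc d ℕ.^ n
      lhs : frac B 0 ℚ.* pow n ℚ.* frac D 0 ≡ frac (B ℕ.* a ℕ.^ n) 0
      lhs = trans (ℚₚ.*-assoc (frac B 0) (pow n) (frac D 0))
        (trans (cong (frac B 0 ℚ.*_) (pow-frac a d γ≡ n)) (frac-* B (a ℕ.^ n)))

-- The enumeration of the field elements.

module FieldElements {q : ℕ} (𝔽 : FiniteField q) where

  open FiniteField 𝔽
  open Linear 𝔽 using (_≟F_)

  ∑-allFin-once : ∀ {N} (r : Fin N) → ∑ (allFin N) (λ i → ind (r Finₚ.≟ i)) ≡ 1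
  ∑-allFin-once {suc N} r = trans
    (cong (λ z → ind (r Finₚ.≟ Fin.zero) ℕ.+ ∑ z (λ i → ind (r Finₚ.≟ i))) (sym (Listₚ.map-tabulate (λ i → i) Fin.suc)))
    (trans (cong (ind (r Finₚ.≟ Fin.zero) ℕ.+_) (∑-map Fin.suc (allFin N) (λ i → ind (r Finₚ.≟ i)))) (at r))
    where
    at : ∀ r → ind (r Finₚ.≟ Fin.zero) ℕ.+ ∑ (allFin N) (λ i → ind (r Finₚ.≟ Fin.suc i)) ≡ 1
    at Fin.zero    = cong suc (∑-zero (allFin N))
    at (Fin.suc r) = trans
      (∑-cong (allFin N) λ i → ind-cong (Fin.suc r Finₚ.≟ Fin.suc i) (r Finₚ.≟ i) Finₚ.suc-injective (cong Fin.suc))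
      (∑-allFin-once r)

  finiteF : Finite F
  finiteF = record { all = elements ; _≟_ = _≟F_ ; once = once }
    where
    once : ∀ x → ∑ elements (λ y → ind (x ≟F y)) ≡ 1
    once x = trans (∑-map (Inverse.to enum) (allFin q) _)
      (trans (∑-cong (allFin q) λ i → ind-cong (x ≟F Inverse.to enum i) (Inverse.from enum x Finₚ.≟ i)
                (Inverse.inverseʳ enum) (sym ∘ Inverse.inverseˡ enum ∘ sym))
             (∑-allFin-once (Inverse.from enum x)))

  length-elements : length elements ≡ q
  length-elements = trans (Listₚ.length-map _ (allFin q)) (Listₚ.length-tabulate (λ i → i))

  allVecs≡allVec : ∀ n → allVecs n ≡ allVec elements n
  allVecs≡allVec zero    = refl
  allVecs≡allVec (suc n) = cong (λ l → List.concatMap (λ a → List.map (a ∷_) l) elements) (allVecs≡allVec n)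

-- Solution counts as sums over tuples.

module Solutions {q : ℕ} (𝔽 : FiniteField q) (finiteF : Finite (FiniteField.F 𝔽)) (n m : ℕ) where

  open FiniteField 𝔽
  open Linear 𝔽
  open Counting 𝔽 finiteF n m
  open Finite finiteV using () renaming (all to allV)
  open Finite finiteW using (_≟_)

  weight : ∀ {k} → (Vec F n → ℕ) → Vec (Vec F n) k → ℕ
  weight S []       = 1
  weight S (x ∷ xs) = S x ℕ.* weight S xs

  weight-ones : ∀ {k} (xs : Vec (Vec F n) k) → weight (λ _ → 1) xs ≡ 1
  weight-ones []       = refl
  weight-ones (x ∷ xs) = trans (ℕₚ.*-identityˡ _) (weight-ones xs)

  weight≤1 : ∀ {k} (S : Vec F n → ℕ) → (∀ x → S x ℕ.≤ 1) → (xs : Vec (Vec F n) k) → weight S xs ℕ.≤ 1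
  weight≤1 S S≤1 []       = ℕₚ.≤-refl
  weight≤1 S S≤1 (x ∷ xs) = ℕₚ.*-mono-≤ (S≤1 x) (weight≤1 S S≤1 xs)

  weight>0 : ∀ {k} (S : Vec F n → ℕ) (xs : Vec (Vec F n) k) → 0 ℕ.< weight S xs →
    ∀ j → 0 ℕ.< S (Vec.lookup xs j)
  weight>0 S (x ∷ xs) pos Fin.zero    with S x
  ... | suc _ = ℕ.s≤s ℕ.z≤n
  weight>0 S (x ∷ xs) pos (Fin.suc j) = weight>0 S xs (positive-factor (S x) pos) j
    where
    positive-factor : ∀ a {b} → 0 ℕ.< a ℕ.* b → 0 ℕ.< b
    positive-factor a {zero}  lt = contradiction (ℕₚ.*-zeroʳ a) (ℕₚ.>⇒≢ lt)
    positive-factor a {suc b} lt = ℕ.s≤s ℕ.z≤n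

  -- The running total is accumulated in the order used by `hist`, so that `hist≡∑` unfolds without
  -- rearranging sums.
  eval : ∀ {k} → Vec (Vec F n) m → (Fin k → Vec F m) → Vec (Vec F n) k → Vec (Vec F n) m
  eval w cs []       = w
  eval w cs (x ∷ xs) = eval (w ⊞ cs Fin.zero ⊗ x) (cs ∘ Fin.suc) xs

  hist≡∑ : ∀ {k} S (cs : Fin k → Vec F m) w →
    hist S (List.tabulate cs) w ≡ ∑ (allVec allV k) (λ xs → weight S xs ℕ.* ind (eval w cs xs ≟ 0W))
  hist≡∑ {zero}  S cs w = sym (trans (ℕₚ.+-identityʳ _) (ℕₚ.*-identityˡ _))
  hist≡∑ {suc k} S cs w = begin
    ∑ allV (λ x → S x ℕ.* hist S (List.tabulate (cs ∘ Fin.suc)) (w ⊞ cs Fin.zero ⊗ x))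
      ≡⟨ ∑-cong allV (λ x → cong (S x ℕ.*_) (hist≡∑ S (cs ∘ Fin.suc) _)) ⟩
    ∑ allV (λ x → S x ℕ.* ∑ (allVec allV k) (λ xs → weight S xs ℕ.* ind (eval w cs (x ∷ xs) ≟ 0W)))
      ≡⟨ ∑-cong allV (λ x → trans (*-∑ (allVec allV k) (S x) _)
           (∑-cong (allVec allV k) λ xs → sym (ℕₚ.*-assoc (S x) (weight S xs) _))) ⟩
    ∑ allV (λ x → ∑ (allVec allV k) (λ xs → weight S (x ∷ xs) ℕ.* ind (eval w cs (x ∷ xs) ≟ 0W)))
      ≡⟨ ∑-allVec allV k _ ⟨
    ∑ (allVec allV (suc k)) (λ xs → weight S xs ℕ.* ind (eval w cs xs ≟ 0W)) ∎
    where open ≡-Reasoning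

  entry : Vec (Vec F n) m → Fin m → Fin n → F
  entry w i t = Vec.lookup (Vec.lookup w i) t

  entry-0W : ∀ i t → entry 0W i t ≡ 0#
  entry-0W i t = trans (cong (λ v → Vec.lookup v t) (lookup-replicate i 0V)) (lookup-replicate t 0#)

  entry-⊞⊗ : ∀ w c x i t → entry (w ⊞ c ⊗ x) i t ≡ entry w i t + Vec.lookup c i * Vec.lookup x t
  entry-⊞⊗ w c x i t = trans (cong (λ v → Vec.lookup v t) (lookup-zipWith _⊕_ i w (c ⊗ x)))
    (trans (lookup-zipWith _+_ t (Vec.lookup w i) (Vec.lookup (c ⊗ x) i))
      (cong (entry w i t +_) (trans (cong (λ v → Vec.lookup v t) (lookup-map i (_· x) c)) (lookup-map t (Vec.lookup c i *_) x))))

  entry-eval : ∀ {k} w (cs : Fin k → Vec F m) xs i t →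
    entry (eval w cs xs) i t ≡ entry w i t + Σ[ (λ j → Vec.lookup (cs j) i * Vec.lookup (Vec.lookup xs j) t) ]
  entry-eval w cs []       i t = sym (R.+-identityʳ _)
  entry-eval w cs (x ∷ xs) i t = trans (entry-eval (w ⊞ cs Fin.zero ⊗ x) (cs ∘ Fin.suc) xs i t)
    (trans (cong (_+ _) (entry-⊞⊗ w (cs Fin.zero) x i t)) (R.+-assoc _ _ _))

  module _ {k : ℕ} (A : Matrix m k) where

    open Columns 𝔽 A

    entry-eval-column : ∀ xs i t →
      entry (eval 0W column xs) i t ≡ Σ[ (λ j → A i j * Vec.lookup (Vec.lookup xs j) t) ]
    entry-eval-column xs i t = trans (entry-eval 0W column xs i t)
      (trans (cong₂ _+_ (entry-0W i t) (Σ-cong λ j → cong (_* Vec.lookup (Vec.lookup xs j) t) (lookup∘tabulate (λ i → A i j) i)))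
             (R.+-identityˡ _))

    eval≡0⇒solution : ∀ xs → eval 0W column xs ≡ 0W → IsSolution A (Vec.lookup xs)
    eval≡0⇒solution xs e i t = trans (sym (entry-eval-column xs i t)) (trans (cong (λ w → entry w i t) e) (entry-0W i t))

    solution⇒eval≡0 : ∀ xs → IsSolution A (Vec.lookup xs) → eval 0W column xs ≡ 0W
    solution⇒eval≡0 xs sol = all-zero (eval 0W column xs) λ i →
      lookup⇒≡0V _ λ t → trans (entry-eval-column xs i t) (sol i t)
      where
      all-zero : ∀ {m} (w : Vec (Vec F n) m) → (∀ i → Vec.lookup w i ≡ 0V) → w ≡ 0W
      all-zero []      e = refl
      all-zero (v ∷ w) e = cong₂ _∷_ (e Fin.zero) (all-zero w (e ∘ Fin.suc))

    solves? : ∀ xs → Dec (eval 0W column xs ≡ 0W)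
    solves? xs = eval 0W column xs ≟ 0W

    isSolution : Vec (Vec F n) k → ℕ
    isSolution xs = ind (solves? xs)

    -- Full row rank makes the columns span, so `count-spanning` applies. For a system with an added
    -- equation x_i = x_j this counts degenerate solutions.
    ∑-isSolution : FullRowRank → Q ℕ.^ m ℕ.* ∑ (allVec allV k) isSolution ≡ Q ℕ.^ k
    ∑-isSolution full = begin
      Q ℕ.^ m ℕ.* ∑ (allVec allV k) isSolution       ≡⟨ cong (Q ℕ.^ m ℕ.*_) (∑-cong (allVec allV k) λ xs → trans (sym (ℕₚ.*-identityˡ _)) (cong (ℕ._* isSolution xs) (sym (weight-ones xs)))) ⟩
      Q ℕ.^ m ℕ.* ∑ (allVec allV k) (λ xs → weight (λ _ → 1) xs ℕ.* isSolution xs)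
                                                     ≡⟨ cong (Q ℕ.^ m ℕ.*_) (hist≡∑ (λ _ → 1) column 0W) ⟨
      Q ℕ.^ m ℕ.* count columnList 0W                ≡⟨ count-spanning columnList (columnList-spanning full) 0W ⟩
      Q ℕ.^ length columnList                        ≡⟨ cong (Q ℕ.^_) (Listₚ.length-tabulate column) ⟩
      Q ℕ.^ k                                        ∎
      where open ≡-Reasoning

-- Solutions with two equal entries.

module Coincidence {q : ℕ} (𝔽 : FiniteField q) {m k : ℕ} (A : FiniteField.Matrix 𝔽 m k) (j₁ j₂ : Fin k) where

  open FiniteField 𝔽
  open Linear 𝔽

  unit : Fin k → F → Fin k → F
  unit a c j = if does (a Finₚ.≟ j) then c else 0#

  unit-same : ∀ a c → unit a c a ≡ c
  unit-same a c with a Finₚ.≟ a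
  ... | yes _  = refl
  ... | no a≢a = contradiction refl a≢a

  unit-other : ∀ {a j} c → a ≢ j → unit a c j ≡ 0#
  unit-other {a} {j} c a≢j with a Finₚ.≟ j
  ... | yes a≡j = contradiction a≡j a≢j
  ... | no _    = refl

  difference : Fin k → F
  difference j = unit j₁ 1# j + unit j₂ (- 1#) j

  -- A together with the equation x_{j₁} − x_{j₂} = 0.
  extended : Matrix (suc m) k
  extended Fin.zero    j = difference j
  extended (Fin.suc i) j = A i j

  difference-off : ∀ {j} → j₁ ≢ j → j₂ ≢ j → difference j ≡ 0#
  difference-off ne₁ ne₂ = trans (cong₂ _+_ (unit-other 1# ne₁) (unit-other (- 1#) ne₂)) (R.+-identityˡ 0#)

  difference-j₁ : j₁ ≢ j₂ → difference j₁ ≡ 1#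
  difference-j₁ ne = trans (cong₂ _+_ (unit-same j₁ 1#) (unit-other (- 1#) (ne ∘ sym))) (R.+-identityʳ 1#)

  Σ-zero : ∀ {k} {f : Fin k → F} → (∀ j → f j ≡ 0#) → Σ[ f ] ≡ 0#
  Σ-zero {zero}  e = refl
  Σ-zero {suc k} e = trans (cong₂ _+_ (e Fin.zero) (Σ-zero (e ∘ Fin.suc))) (R.+-identityˡ 0#)

  Σ-single : ∀ {k} (a : Fin k) (f : Fin k → F) → (∀ j → a ≢ j → f j ≡ 0#) → Σ[ f ] ≡ f a
  Σ-single Fin.zero    f e = trans (cong (f Fin.zero +_) (Σ-zero λ j → e (Fin.suc j) λ ())) (R.+-identityʳ _)
  Σ-single (Fin.suc a) f e = trans
    (cong₂ _+_ (e Fin.zero λ ()) (Σ-single a (f ∘ Fin.suc) λ j a≢j → e (Fin.suc j) (a≢j ∘ Finₚ.suc-injective)))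
    (R.+-identityˡ _)

  Σ-unit : ∀ a c (y : Fin k → F) → Σ[ (λ j → unit a c j * y j) ] ≡ c * y a
  Σ-unit a c y = trans
    (Σ-single a (λ j → unit a c j * y j) λ j a≢j → trans (cong (_* y j) (unit-other c a≢j)) (R.zeroˡ (y j)))
    (cong (_* y a) (unit-same a c))

  extended-solution : ∀ {n} (x : Fin k → Vec F n) → IsSolution A x → x j₁ ≡ x j₂ → IsSolution extended x
  extended-solution x sol eq (Fin.suc i) t = sol i t
  extended-solution x sol eq Fin.zero    t = begin
    Σ[ (λ j → difference j * y j) ]
      ≡⟨ Σ-cong (λ j → R.distribʳ (y j) (unit j₁ 1# j) (unit j₂ (- 1#) j)) ⟩
    Σ[ (λ j → unit j₁ 1# j * y j + unit j₂ (- 1#) j * y j) ]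
      ≡⟨ Σ-+ (λ j → unit j₁ 1# j * y j) (λ j → unit j₂ (- 1#) j * y j) ⟩
    Σ[ (λ j → unit j₁ 1# j * y j) ] + Σ[ (λ j → unit j₂ (- 1#) j * y j) ]
      ≡⟨ cong₂ _+_ (Σ-unit j₁ 1# y) (Σ-unit j₂ (- 1#) y) ⟩
    1# * y j₁ + - 1# * y j₂
      ≡⟨ cong (λ z → 1# * y j₁ + - 1# * Vec.lookup z t) eq ⟨
    1# * y j₁ + - 1# * y j₁
      ≡⟨ R.distribʳ (y j₁) 1# (- 1#) ⟨
    (1# + - 1#) * y j₁
      ≡⟨ cong (_* y j₁) (R.-‿inverseʳ 1#) ⟩
    0# * y j₁
      ≡⟨ R.zeroˡ (y j₁) ⟩
    0# ∎
    where
    open ≡-Reasoning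
    y : Fin k → F
    y j = Vec.lookup (x j) t

  module _ (s : ℕ) (part : Fin k → Fin (s ℕ.+ s)) (full : Columns.FullRowRank 𝔽 A)
    (condI : CondI A s part) (condII : CondII A s part) (j₁≢j₂ : j₁ ≢ j₂) where

    open Blocks 𝔽 A s part full condI condII using (b; left; right; left≢right; dot-b; dot-left)

    -- Here x and y will be the blocks of the two indices, and t, u, v three blocks that meet the
    -- support.
    pigeonhole : {X : Set} {x y t u v : X} → x ≡ t ⊎ y ≡ t → x ≡ u ⊎ y ≡ u → x ≡ v ⊎ y ≡ v →
      t ≡ u ⊎ t ≡ v ⊎ u ≡ v
    pigeonhole (inj₁ a) (inj₁ c) _        = inj₁ (trans (sym a) c)
    pigeonhole (inj₂ a) (inj₂ c) _        = inj₁ (trans (sym a) c)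
    pigeonhole (inj₁ a) (inj₂ _) (inj₁ c) = inj₂ (inj₁ (trans (sym a) c))
    pigeonhole (inj₁ _) (inj₂ a) (inj₂ c) = inj₂ (inj₂ (trans (sym a) c))
    pigeonhole (inj₂ _) (inj₁ a) (inj₁ c) = inj₂ (inj₂ (trans (sym a) c))
    pigeonhole (inj₂ a) (inj₁ _) (inj₂ c) = inj₂ (inj₁ (trans (sym a) c))

    block-meets-support : ∀ {f : Fin k → F} → (∀ j → j₁ ≢ j → j₂ ≢ j → f j ≡ 0#) →
      ∀ t → ΣOver (inBlock A s part t) f ≢ 0# → part j₁ ≡ t ⊎ part j₂ ≡ t
    block-meets-support {f} off t nz with part j₁ Finₚ.≟ t | part j₂ Finₚ.≟ t
    ... | yes e | _     = inj₁ e
    ... | no _  | yes e = inj₂ e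
    ... | no n₁ | no n₂ = contradiction (Σ-zero vanish) nz
      where
      vanish : ∀ j → (if inBlock A s part t j then f j else 0#) ≡ 0#
      vanish j with part j Finₚ.≟ t
      ... | no _  = refl
      ... | yes e = off j (λ { refl → n₁ e }) (λ { refl → n₂ e })

    -- A nonzero row combination has nonzero sum over four blocks, so its support exceeds {j₁, j₂}.
    support-too-small : ∀ l → (∀ j → j₁ ≢ j → j₂ ≢ j → rowComb A (Vec.lookup l) j ≡ 0#) →
      ∀ j → rowComb A (Vec.lookup l) j ≡ 0#
    support-too-small l off j = decidable-stable (rowComb A (Vec.lookup l) j ≟F 0#) absurd
      where
      absurd : rowComb A (Vec.lookup l) j ≢ 0# → ⊥
      absurd nz with condII (Vec.lookup l) (j , nz)
      ... | r₁ , r₂ , r₁≢r₂ , nz₁ , nz₂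
        -- Three blocks already suffice: `P_{r₁}`, `P_{r₂}` and `P_{s+r₁}`, the sum over the last
        -- being nonzero by (i).
        with pigeonhole (block-meets-support off (left r₁) nz₁) (block-meets-support off (left r₂) nz₂)
               (block-meets-support off (right r₁) λ z →
                 nz₁ (trans (sym (dot-b l (left r₁))) (dot-left l r₁ (trans (dot-b l (right r₁)) z))))
      ... | inj₁ e        = r₁≢r₂ (Finₚ.↑ˡ-injective s r₁ r₂ e)
      ... | inj₂ (inj₁ e) = left≢right e
      ... | inj₂ (inj₂ e) = left≢right e

    -- In a vanishing combination the part coming from A cancels μ times the new row, so it is
    -- supported on j₁ and j₂ and vanishes by `support-too-small`. Then entry j₁ gives μ = 0, and
    -- full row rank of A gives the rest.
    extended-fullRowRank : Columns.FullRowRank 𝔽 extended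
    extended-fullRowRank λs kills = all-zero
      where
      open ≡-Reasoning
      μ : F
      μ = λs Fin.zero
      l : Vec F m
      l = Vec.tabulate (λs ∘ Fin.suc)
      f : Fin k → F
      f = rowComb A (Vec.lookup l)
      f≡ : ∀ j → f j ≡ rowComb A (λs ∘ Fin.suc) j
      f≡ j = Σ-cong λ i → cong (_* A i j) (lookup∘tabulate (λs ∘ Fin.suc) i)
      relation : ∀ j → μ * difference j + f j ≡ 0#
      relation j = trans (cong (μ * difference j +_) (f≡ j)) (kills j)
      off : ∀ j → j₁ ≢ j → j₂ ≢ j → f j ≡ 0#
      off j ne₁ ne₂ = begin
        f j                       ≡⟨ R.+-identityˡ (f j) ⟨
        0# + f j                  ≡⟨ cong (_+ f j) (trans (cong (μ *_) (difference-off ne₁ ne₂)) (R.zeroʳ μ)) ⟨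
        μ * difference j + f j    ≡⟨ relation j ⟩
        0#                        ∎
      f-zero : ∀ j → f j ≡ 0#
      f-zero = support-too-small l off
      all-zero : ∀ i → λs i ≡ 0#
      all-zero Fin.zero = begin
        μ                           ≡⟨ R.*-identityʳ μ ⟨
        μ * 1#                      ≡⟨ cong (μ *_) (difference-j₁ j₁≢j₂) ⟨
        μ * difference j₁           ≡⟨ R.+-identityʳ _ ⟨
        μ * difference j₁ + 0#      ≡⟨ cong (μ * difference j₁ +_) (f-zero j₁) ⟨
        μ * difference j₁ + f j₁    ≡⟨ relation j₁ ⟩
        0#                          ∎
      all-zero (Fin.suc i) = full (λs ∘ Fin.suc) (λ j → trans (sym (f≡ j)) (f-zero j)) i

-- Comparing the solutions in S with the degenerate ones, and the constants β and γ.

module Assembly {q : ℕ} (𝔽 : FiniteField q) (2≤q : 2 ℕ.≤ q) {m k : ℕ} (A : FiniteField.Matrix 𝔽 m k)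
  (s : ℕ) (part : Fin k → Fin (s ℕ.+ s)) (full : Columns.FullRowRank 𝔽 A)
  (condI : FiniteField.CondI 𝔽 A s part) (condII : FiniteField.CondII 𝔽 A s part) where

  open FiniteField 𝔽
  open Linear 𝔽
  open FieldElements 𝔽
  open Columns 𝔽 A using (column; columnList)
  open Blocks 𝔽 A s part full condI condII using (exponent; dense-columnList)
  open Coincidence 𝔽 A using (extended; extended-solution; extended-fullRowRank)

  module _ (n : ℕ) (S : Vec F n → Bool) where

    open Counting 𝔽 finiteF n m using (Q; hist; module Density)
    open Solutions 𝔽 finiteF n m
    module Solutions₊ = Solutions 𝔽 finiteF n (suc m)
    open Finite (finiteVec finiteF n) using () renaming (all to allV)

    1ₛ : Vec F n → ℕ
    1ₛ x = if S x then 1 else 0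

    1ₛ≤1 : ∀ x → 1ₛ x ℕ.≤ 1
    1ₛ≤1 x with S x
    ... | true  = ℕₚ.≤-refl
    ... | false = ℕ.z≤n

    open Density 1ₛ 1ₛ≤1 using (σ; dense-suc; Q^-nonZero)

    Q≡q^n : Q ≡ q ℕ.^ n
    Q≡q^n = trans (length-allVec elements n) (cong (ℕ._^ n) length-elements)

    card≡σ : card S ≡ σ
    card≡σ = cong (λ l → ∑ l 1ₛ) (allVecs≡allVec n)

    found : Vec (Vec F n) k → ℕ
    found xs = weight 1ₛ xs ℕ.* isSolution A xs

    -- Degenerate solutions are counted among all tuples, not only those in S. The diagonal is set
    -- to 0 because x_j = x_j is no coincidence.
    coincident : Fin k → Fin k → Vec (Vec F n) k → ℕ
    coincident j₁ j₂ xs = if does (j₁ Finₚ.≟ j₂) then 0 else Solutions₊.isSolution (extended j₁ j₂) xs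

    -- A union bound: a tuple is counted once for every ordered pair of equal entries.
    degenerate : Vec (Vec F n) k → ℕ
    degenerate xs = ∑ (allFin k) λ j₁ → ∑ (allFin k) λ j₂ → coincident j₁ j₂ xs

    term≤∑ : ∀ {N} (j : Fin N) (f : Fin N → ℕ) → f j ℕ.≤ ∑ (allFin N) f
    term≤∑ {N} j f = subst (ℕ._≤ ∑ (allFin N) f)
      (trans (sym (∑-* (allFin N) (f j) _)) (trans (cong (ℕ._* f j) (∑-allFin-once j)) (ℕₚ.*-identityˡ (f j))))
      (∑-mono (allFin N) at)
      where
      at : ∀ i → ind (j Finₚ.≟ i) ℕ.* f j ℕ.≤ f i
      at i with j Finₚ.≟ i
      ... | yes refl = ℕₚ.≤-reflexive (ℕₚ.*-identityˡ (f i))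
      ... | no _     = ℕ.z≤n

    ∑-coincident : ∀ j₁ j₂ → Q ℕ.^ suc m ℕ.* ∑ (allVec allV k) (coincident j₁ j₂) ℕ.≤ Q ℕ.^ k
    ∑-coincident j₁ j₂ with j₁ Finₚ.≟ j₂
    ... | yes _  = ℕₚ.≤-trans (ℕₚ.≤-reflexive (trans (cong (Q ℕ.^ suc m ℕ.*_) (∑-zero (allVec allV k))) (ℕₚ.*-zeroʳ (Q ℕ.^ suc m)))) ℕ.z≤n
    ... | no ne  = ℕₚ.≤-reflexive (Solutions₊.∑-isSolution (extended j₁ j₂)
                     (extended-fullRowRank j₁ j₂ s part full condI condII ne))

    ∑-degenerate : Q ℕ.^ suc m ℕ.* ∑ (allVec allV k) degenerate ℕ.≤ k ℕ.* k ℕ.* Q ℕ.^ k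
    ∑-degenerate = begin
      M ℕ.* ∑ (allVec allV k) degenerate
        ≡⟨ cong (M ℕ.*_) (trans (∑-swap (allVec allV k) (allFin k) _) (∑-cong (allFin k) λ j₁ → ∑-swap (allVec allV k) (allFin k) _)) ⟩
      M ℕ.* ∑ (allFin k) (λ j₁ → ∑ (allFin k) λ j₂ → ∑ (allVec allV k) (coincident j₁ j₂))
        ≡⟨ trans (*-∑ (allFin k) M _) (∑-cong (allFin k) λ j₁ → *-∑ (allFin k) M _) ⟩
      ∑ (allFin k) (λ j₁ → ∑ (allFin k) λ j₂ → M ℕ.* ∑ (allVec allV k) (coincident j₁ j₂))
        ≤⟨ ∑-mono (allFin k) (λ j₁ → ∑-mono (allFin k) (∑-coincident j₁)) ⟩
      ∑ (allFin k) (λ j₁ → ∑ (allFin k) λ j₂ → Q ℕ.^ k)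
        ≡⟨ trans (∑-const (allFin k) _) (cong₂ ℕ._*_ length-allFin (trans (∑-const (allFin k) _) (cong (ℕ._* Q ℕ.^ k) length-allFin))) ⟩
      k ℕ.* (k ℕ.* Q ℕ.^ k)
        ≡⟨ ℕₚ.*-assoc k k _ ⟨
      k ℕ.* k ℕ.* Q ℕ.^ k ∎
      where
      open ℕₚ.≤-Reasoning
      M : ℕ
      M = Q ℕ.^ suc m
      length-allFin : length (allFin k) ≡ k
      length-allFin = Listₚ.length-tabulate (λ i → i)

    DistinctSolution : Set
    DistinctSolution = ∃[ x ] ((∀ j → S (x j) ≡ true) × Injective _≡_ _≡_ x × IsSolution A x)

    -- `found` is at most 1, so here it is 1 and `degenerate` is 0, whereas a coincidence of two
    -- entries would contribute 1 to the latter.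
    nondegenerate⇒solution : ∀ xs → degenerate xs ℕ.< found xs → DistinctSolution
    nondegenerate⇒solution xs lt = Vec.lookup xs , inS , distinct , solution
      where
      factors : ∀ a {b} → 0 ℕ.< a ℕ.* b → 0 ℕ.< a × 0 ℕ.< b
      factors (suc a) {suc b} _  = ℕ.s≤s ℕ.z≤n , ℕ.s≤s ℕ.z≤n
      factors (suc a) {zero}  lt = contradiction (ℕₚ.*-zeroʳ a) (ℕₚ.>⇒≢ lt)
      positive : 0 ℕ.< weight 1ₛ xs × 0 ℕ.< isSolution A xs
      positive = factors (weight 1ₛ xs) (ℕₚ.≤-<-trans ℕ.z≤n lt)
      ind≤1 : {X : Set} (d : Dec X) → ind d ℕ.≤ 1
      ind≤1 (yes _) = ℕₚ.≤-refl
      ind≤1 (no _)  = ℕ.z≤n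
      found≤1 : found xs ℕ.≤ 1
      found≤1 = ℕₚ.*-mono-≤ (weight≤1 1ₛ 1ₛ≤1 xs) (ind≤1 (solves? A xs))
      inS : ∀ j → S (Vec.lookup xs j) ≡ true
      inS j with S (Vec.lookup xs j) | weight>0 1ₛ xs (proj₁ positive) j
      ... | true | _ = refl
      solution : IsSolution A (Vec.lookup xs)
      solution = eval≡0⇒solution A xs (ind⇒ (solves? A xs) (proj₂ positive))
      degenerate≥1 : ∀ {j₁ j₂} → j₁ ≢ j₂ → Vec.lookup xs j₁ ≡ Vec.lookup xs j₂ → 1 ℕ.≤ degenerate xs
      degenerate≥1 {j₁} {j₂} ne eq = begin
        1                                             ≡⟨ one ⟨
        coincident j₁ j₂ xs                           ≤⟨ term≤∑ j₂ (λ j → coincident j₁ j xs) ⟩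
        ∑ (allFin k) (λ j → coincident j₁ j xs)       ≤⟨ term≤∑ j₁ (λ i → ∑ (allFin k) (λ j → coincident i j xs)) ⟩
        degenerate xs                                 ∎
        where
        open ℕₚ.≤-Reasoning
        one : coincident j₁ j₂ xs ≡ 1
        one with j₁ Finₚ.≟ j₂
        ... | yes e = contradiction e ne
        ... | no _  = ind-yes (Solutions₊.solves? (extended j₁ j₂) xs) (Solutions₊.solution⇒eval≡0 (extended j₁ j₂) xs
                        (extended-solution j₁ j₂ (Vec.lookup xs) solution eq))
      distinct : Injective _≡_ _≡_ (Vec.lookup xs)
      distinct {j₁} {j₂} eq = decidable-stable (j₁ Finₚ.≟ j₂) λ ne →
        ℕₚ.<⇒≱ lt (ℕₚ.≤-trans found≤1 (degenerate≥1 ne eq))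

    -- The first alternative is δ ^ e Q ≤ k² with cleared denominators. It arises when the lower
    -- bound for the solutions in S meets the upper bound for degenerate ones.
    few-or-solution : Q ℕ.* σ ℕ.^ suc exponent ℕ.≤ k ℕ.* k ℕ.* Q ℕ.^ suc exponent ⊎ DistinctSolution
    few-or-solution with ∑≤⊎> (allVec allV k) found degenerate
    ... | inj₂ (xs , lt) = inj₂ (nondegenerate⇒solution xs lt)
    ... | inj₁ le = inj₁ (ℕₚ.*-cancelʳ-≤ _ _ (Q ℕ.^ k) {{Q^-nonZero k}} (begin
      Q ℕ.* σ ℕ.^ e ℕ.* Q ℕ.^ k                     ≡⟨ ℕₚ.*-assoc Q _ _ ⟩
      Q ℕ.* (σ ℕ.^ e ℕ.* Q ℕ.^ k)                   ≤⟨ ℕₚ.*-monoʳ-≤ Q dense ⟩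
      Q ℕ.* (H ℕ.* (Q ℕ.^ m ℕ.* Q ℕ.^ e))           ≡⟨ rearrange Q H (Q ℕ.^ m) (Q ℕ.^ e) ⟩
      Q ℕ.^ suc m ℕ.* H ℕ.* Q ℕ.^ e                 ≤⟨ ℕₚ.*-monoˡ-≤ _ (ℕₚ.*-monoʳ-≤ (Q ℕ.^ suc m) (ℕₚ.≤-trans (ℕₚ.≤-reflexive (hist≡∑ 1ₛ column _)) le)) ⟩
      Q ℕ.^ suc m ℕ.* ∑ (allVec allV k) degenerate ℕ.* Q ℕ.^ e
                                                    ≤⟨ ℕₚ.*-monoˡ-≤ _ ∑-degenerate ⟩
      k ℕ.* k ℕ.* Q ℕ.^ k ℕ.* Q ℕ.^ e               ≡⟨ rearrange′ (k ℕ.* k) (Q ℕ.^ k) (Q ℕ.^ e) ⟩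
      k ℕ.* k ℕ.* Q ℕ.^ e ℕ.* Q ℕ.^ k               ∎))
      where
      open ℕₚ.≤-Reasoning
      e H : ℕ
      e = suc exponent
      H = hist 1ₛ columnList 0W
      dense : σ ℕ.^ e ℕ.* Q ℕ.^ k ℕ.≤ H ℕ.* (Q ℕ.^ m ℕ.* Q ℕ.^ e)
      dense = subst (λ t → σ ℕ.^ e ℕ.* Q ℕ.^ t ℕ.≤ H ℕ.* (Q ℕ.^ m ℕ.* Q ℕ.^ e)) (Listₚ.length-tabulate column)
        (dense-suc {exponent} {columnList} (dense-columnList finiteF n 1ₛ 1ₛ≤1))
      rearrange : ∀ a h b c → a ℕ.* (h ℕ.* (b ℕ.* c)) ≡ a ℕ.* b ℕ.* h ℕ.* c
      rearrange = solve-∀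
      rearrange′ : ∀ a b c → a ℕ.* b ℕ.* c ≡ a ℕ.* c ℕ.* b
      rearrange′ = solve-∀

  open Fractions
  open Arithmetic

  -- Chosen so that d + 1 = 2 (exponent + 1), the denominator in `density-contradiction`.
  d : ℕ
  d = suc (exponent ℕ.+ exponent)

  -- With e = suc exponent, γ = q (1 − 1 / (2 e)), so that γ ^ e ≥ q ^ e / 2 ≥ q ^ (e − 1).
  β γ : ℚ
  β = frac (suc (k ℕ.* k)) 0
  γ = frac (q ℕ.* d) d

  instance
    q-nonZero : ℕ.NonZero q
    q-nonZero = ℕ.>-nonZero (ℕₚ.≤-trans (ℕ.s≤s ℕ.z≤n) 2≤q)

  γ<q : γ ℚ.< frac q 0
  γ<q = frac-< (q ℕ.* d) d q (ℕₚ.*-monoʳ-< q (ℕₚ.n<1+n d))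

  -- The power function local to Moderate cannot be named here, so it enters through its equations.
  dense⇒solution : (pow : ℕ → ℚ) → pow 0 ≡ 1ℚ → (∀ n → pow (suc n) ≡ γ ℚ.* pow n) →
    ∀ n (S : Vec F n → Bool) → β ℚ.* pow n ℚ.≤ frac (card S) 0 → DistinctSolution n S
  dense⇒solution pow pow-zero pow-suc n S le with few-or-solution n S
  ... | inj₂ solution = solution
  ... | inj₁ few = contradiction
    (clear-denominators γ pow pow-zero pow-suc (q ℕ.* d) d refl (suc (k ℕ.* k)) n (card S) le)
    (density-contradiction 2≤q (k ℕ.* k) exponent n (card S)
      (subst₂ (λ Q c → Q ℕ.* c ℕ.^ suc exponent ℕ.≤ k ℕ.* k ℕ.* Q ℕ.^ suc exponent) (Q≡q^n n S) (sym (card≡σ n S)) few))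

  moderate : Moderate A
  moderate = β , γ , frac-positive (suc (k ℕ.* k)) 0 , frac-positive (q ℕ.* d) d {{ℕₚ.m*n≢0 q d}} , γ<q ,
    dense⇒solution _ refl (λ _ → refl)

primePower⇒2≤ : ∀ {q} → IsPrimePower q → 2 ℕ.≤ q
primePower⇒2≤ (p , e , p-prime , refl) =
  ℕₚ.≤-trans (ℕ.nonTrivial⇒n>1 p) (ℕₚ.m≤m*n p (p ℕ.^ e) {{ℕₚ.m^n≢0 p e}})
  where
  instance
    p-nonTrivial : ℕ.NonTrivial p
    p-nonTrivial = prime⇒nonTrivial p-prime
    p-nonZero : ℕ.NonZero p
    p-nonZero = prime⇒nonZero p-prime

theorem4p2 : (q : ℕ) → IsPrimePower q → (𝔽 : FiniteField q) →
    let open FiniteField 𝔽 in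
    (m k : ℕ) (A : Matrix m k) →
    TypeRC A → NonDegenerate A → Irreducible A →
    (s : ℕ) (part : Fin k → Fin (s ℕ.+ s)) →
    BlocksNonempty A s part →
    CondI A s part → CondII A s part → CondIII A s part →
    Moderate A
theorem4p2 q primePower 𝔽 m k A _ (full , _) _ s part _ condI condII _ =
  Assembly.moderate 𝔽 (primePower⇒2≤ primePower) A s part full condI condII
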